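{- Let $r,s$ be coprime positive integers with $1\le s<r/2$ and let $k\ge 1$ be an integer. (1) If $2\mid s$ and $k>\dfrac{4r^3s-2s(r-2s)}{r(r-2s)}$, then for all $n\ge 0$ the coefficient of $q^n$ in $$\frac{\sum_{j=0}^{\infty}(-1)^{j}q^{r(j^{2}+(2k+1)j)/2-sj}\left(1-q^{2js+(2k+1)s}\right)}{(1-q^{s})(1-q^{r-s})(1-q^{r+s})}$$ is nonnegative. (2) If $2\nmid s$ and $k>\dfrac{8r^3s-2s(r-2s)}{r(r-2s)}$, then for all $n\ge 0$ the coefficient of $q^n$ in $$\frac{\sum_{j=0}^{\infty}(-1)^{j}q^{r(j^{2}+(2k+1)j)/2-sj}\left(1-q^{2js+(2k+1)s}\right)}{(1-q^{s})(1-q^{r-s})(1-q^{2r-s})}$$ is nonnegative. Moreover, in each of the cases (1) and (2), all coefficients of $$(-1)^{k}\,\frac{\sum_{j=k}^{\infty}(-1)^j q^{r j(j+1)/2}\left(q^{ -sj}-q^{(j+1)s}\right)}{\left(q^s,q^{r-s};q^r\right)_{\infty}}$$ are nonnegative.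
   Context: Notation: $(a;q)_\infty=\prod_{n\ge 0}(1-aq^n)$ and $(a_1,\dots,a_m;q)_\infty=(a_1;q)_\infty\cdots(a_m;q)_\infty$. So $(q^s,q^{r-s};q^r)_\infty=\prod_{n\ge 0}(1-q^{s+rn})(1-q^{r-s+rn})$. -}

module Defs where

open import Data.Fin.Base using (Fin; zero; suc; toℕ)
open import Data.Integer.Base as ℤ using (ℤ; +_; 0ℤ; 1ℤ; -1ℤ)
import Data.Integer.Properties as ℤ
open import Data.Nat.Base
open import Data.Nat.Divisibility using (_∣_; _∣0; ∣-trans; n∣m*n; ∣m∣n⇒∣m+n; m∣m*n)
open import Data.Nat.DivMod using (_/_; m/n*n≡m; m*n/n≡m; /-monoˡ-≤)
open import Data.Nat.Properties
open import Data.Nat.Solver using (module +-*-Solver)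
open import Data.Product.Base using (_×_; _,_)
open import Data.Rational.Unnormalised.Base as ℚᵘ using (ℚᵘ)
open import Function.Base using (_∘_)
open import Relation.Binary.PropositionalEquality
open import Relation.Nullary using (does)
open import Relation.Nullary.Decidable using (dec-false)
open import Data.Bool.Base using (if_then_else_)
open import Algebra.Properties.Monoid.Sum ℤ.+-0-monoid using (sum; sum-syntax; sum⁺-syntax)

------------------------------------------------------------------------
-- Formal power series in q over ℤ, given by their coefficient functions

PowerSeries : Set
PowerSeries = ℕ → ℤ

infixl 6 _-ₚ_
infixl 7 _*ₚ_ _·_ _/ₚ_
infix  8 q^_

q^_ : ℕ → PowerSeries
(q^ a) n = if does (n ≟ a) then 1ℤ else 0ℤ

1ₚ : PowerSeries
1ₚ = q^ 0

_-ₚ_ : PowerSeries → PowerSeries → PowerSeries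
(F -ₚ G) n = F n ℤ.- G n

_·_ : ℤ → PowerSeries → PowerSeries
(c · F) n = c ℤ.* F n

_*ₚ_ : PowerSeries → PowerSeries → PowerSeries
(F *ₚ G) n = ∑[ i ≤ n ] (F (toℕ i) ℤ.* G (n ∸ toℕ i))

-- Long division; this is the quotient whenever G has constant
-- coefficient 1, see /ₚ-*ₚ.
_/ₚ_ : PowerSeries → PowerSeries → PowerSeries
(F /ₚ G) zero    = F 0
(F /ₚ G) (suc n) = ((λ m → F (suc m) ℤ.- F 0 ℤ.* G (suc m)) /ₚ G) n

-- The infinite sum f 0 + f 1 + ⋯, for families with f j = O(q^j): the
-- terms with j > n do not contribute to the coefficient of q^n, see
-- ∑∞-converges.
∑∞ : (ℕ → PowerSeries) → PowerSeries
∑∞ f n = ∑[ j ≤ n ] f (toℕ j) n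

∏< : ℕ → (ℕ → PowerSeries) → PowerSeries
∏< zero    f = 1ₚ
∏< (suc m) f = ∏< m f *ₚ f m

-- The infinite product f 0 · f 1 ⋯, for families with f j = 1 + O(q^j),
-- see ∏∞-converges.
∏∞ : (ℕ → PowerSeries) → PowerSeries
∏∞ f n = ∏< (suc n) f n

------------------------------------------------------------------------
-- The series and bounds of the theorem

-- (q^a ; q^b)_∞
⟨q^_⨾q^_⟩∞ : ℕ → ℕ → PowerSeries
⟨q^ a ⨾q^ b ⟩∞ = ∏∞ λ n → 1ₚ -ₚ q^ (a + b * n)

-- The halving is exact and, when 2s < r, the truncated subtraction is a
-- true one, see exponent-exact.
exponent : (r s k j : ℕ) → ℕ
exponent r s k j = r * (j ^ 2 + (2 * k + 1) * j) / 2 ∸ s * j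

numeratorTerm : (r s k j : ℕ) → PowerSeries
numeratorTerm r s k j =
  (-1ℤ ℤ.^ j) · (q^ (exponent r s k j) *ₚ (1ₚ -ₚ q^ (2 * j * s + (2 * k + 1) * s)))

numerator : (r s k : ℕ) → PowerSeries
numerator r s k = ∑∞ (numeratorTerm r s k)

-- (-1)^j q^{rj(j+1)/2} (q^{-sj} - q^{(j+1)s}), with the first factor
-- multiplied out so that all exponents are natural numbers (2s < r);
-- see tailExponent-exact.
tailTerm : (r s j : ℕ) → PowerSeries
tailTerm r s j =
  (-1ℤ ℤ.^ j) · (q^ (r * (j * (j + 1)) / 2 ∸ s * j) -ₚ q^ (r * (j * (j + 1)) / 2 + (j + 1) * s))

-- The sum of tailTerm r s j over all j ≥ k.
tailSum : (r s k : ℕ) → PowerSeries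
tailSum r s k = ∑∞ λ i → tailTerm r s (k + i)

denominator-nonZero : ∀ {r s} → 2 * s < r → NonZero (r * (r ∸ 2 * s))
denominator-nonZero {r} {s} 2s<r =
  m*n≢0 r (r ∸ 2 * s) {{>-nonZero (≤-<-trans z≤n 2s<r)}} {{>-nonZero (m<n⇒0<n∸m 2s<r)}}

-- (c r³ s - 2s(r - 2s)) / (r(r - 2s))
bound : (c r s : ℕ) → 2 * s < r → ℚᵘ
bound c r s 2s<r =
  ((+ (c * r ^ 3 * s) ℤ.- + (2 * s * (r ∸ 2 * s))) ℚᵘ./ (r * (r ∸ 2 * s)))
    {{denominator-nonZero {r} {s} 2s<r}}

Nonnegative : PowerSeries → Set
Nonnegative F = ∀ n → 0ℤ ℤ.≤ F n

------------------------------------------------------------------------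
-- Correctness of division, infinite sums and infinite products

/ₚ-*ₚ : ∀ F G → G 0 ≡ 1ℤ → ∀ n → ((F /ₚ G) *ₚ G) n ≡ F n
/ₚ-*ₚ F G G₀≡1 zero = begin
  F 0 ℤ.* G 0 ℤ.+ 0ℤ  ≡⟨ ℤ.+-identityʳ _ ⟩
  F 0 ℤ.* G 0         ≡⟨ cong (F 0 ℤ.*_) G₀≡1 ⟩
  F 0 ℤ.* 1ℤ          ≡⟨ ℤ.*-identityʳ (F 0) ⟩
  F 0                 ∎
  where open ≡-Reasoning
/ₚ-*ₚ F G G₀≡1 (suc n) = begin
  x ℤ.+ ((F′ /ₚ G) *ₚ G) n    ≡⟨ cong (λ y → x ℤ.+ y) (/ₚ-*ₚ F′ G G₀≡1 n) ⟩
  x ℤ.+ (F (suc n) ℤ.- x)     ≡⟨ ℤ.+-comm x _ ⟩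
  (F (suc n) ℤ.- x) ℤ.+ x     ≡⟨ ℤ.+-assoc (F (suc n)) (ℤ.- x) x ⟩
  F (suc n) ℤ.+ (ℤ.- x ℤ.+ x) ≡⟨ cong (λ y → F (suc n) ℤ.+ y) (ℤ.+-inverseˡ x) ⟩
  F (suc n) ℤ.+ 0ℤ            ≡⟨ ℤ.+-identityʳ _ ⟩
  F (suc n)                   ∎
  where
  open ≡-Reasoning
  x = F 0 ℤ.* G (suc n)
  F′ : PowerSeries
  F′ m = F (suc m) ℤ.- F 0 ℤ.* G (suc m)

sum-zero : ∀ {n} (g : Fin n → ℤ) → (∀ i → g i ≡ 0ℤ) → sum g ≡ 0ℤ
sum-zero {zero}  g g≡0 = refl
sum-zero {suc n} g g≡0 = cong₂ ℤ._+_ (g≡0 zero) (sum-zero (g ∘ suc) (g≡0 ∘ suc))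

sum-extend : ∀ {m n} (g : ℕ → ℤ) → m ≤ n → (∀ j → m ≤ j → g j ≡ 0ℤ) →
             ∑[ j < n ] g (toℕ j) ≡ ∑[ j < m ] g (toℕ j)
sum-extend {n = n} g z≤n g≡0 = sum-zero {n} (g ∘ toℕ) (λ i → g≡0 (toℕ i) z≤n)
sum-extend g (s≤s m≤n) g≡0 =
  cong (λ y → g 0 ℤ.+ y) (sum-extend (g ∘ suc) m≤n (λ j m≤j → g≡0 (suc j) (s≤s m≤j)))

∑∞-converges : ∀ f → (∀ {j n} → n < j → f j n ≡ 0ℤ) →
               ∀ {n m} → n < m → ∑[ j < m ] f (toℕ j) n ≡ ∑∞ f n
∑∞-converges f ord {n} n<m = sum-extend (λ j → f j n) n<m (λ _ → ord)

*ₚ-lowˡ : ∀ (F G : PowerSeries) n → (∀ {i} → i ≤ n → F i ≡ 0ℤ) → (F *ₚ G) n ≡ 0ℤ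
*ₚ-lowˡ F G zero    F≡0 = cong (λ x → x ℤ.* G 0 ℤ.+ 0ℤ) (F≡0 z≤n)
*ₚ-lowˡ F G (suc n) F≡0 =
  cong₂ (λ x y → x ℤ.* G (suc n) ℤ.+ y) (F≡0 z≤n) (*ₚ-lowˡ (F ∘ suc) G n (F≡0 ∘ s≤s))

*ₚ-trivialʳ : ∀ (F G : PowerSeries) n → G 0 ≡ 1ℤ → (∀ {i} → 0 < i → i ≤ n → G i ≡ 0ℤ) →
              (F *ₚ G) n ≡ F n
*ₚ-trivialʳ F G zero G₀≡1 G≡0 = begin
  F 0 ℤ.* G 0 ℤ.+ 0ℤ  ≡⟨ ℤ.+-identityʳ _ ⟩
  F 0 ℤ.* G 0         ≡⟨ cong (F 0 ℤ.*_) G₀≡1 ⟩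
  F 0 ℤ.* 1ℤ          ≡⟨ ℤ.*-identityʳ (F 0) ⟩
  F 0                 ∎
  where open ≡-Reasoning
*ₚ-trivialʳ F G (suc n) G₀≡1 G≡0 = begin
  F 0 ℤ.* G (suc n) ℤ.+ ((F ∘ suc) *ₚ G) n
    ≡⟨ cong₂ (λ x y → F 0 ℤ.* x ℤ.+ y) (G≡0 z<s ≤-refl)
         (*ₚ-trivialʳ (F ∘ suc) G n G₀≡1 (λ 0<i i≤n → G≡0 0<i (m≤n⇒m≤1+n i≤n))) ⟩
  F 0 ℤ.* 0ℤ ℤ.+ F (suc n)  ≡⟨ cong (ℤ._+ F (suc n)) (ℤ.*-zeroʳ (F 0)) ⟩
  0ℤ ℤ.+ F (suc n)          ≡⟨ ℤ.+-identityˡ _ ⟩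
  F (suc n)                 ∎
  where open ≡-Reasoning

∏∞-converges : ∀ f → (∀ {j} → 0 < j → f j 0 ≡ 1ℤ) → (∀ {j i} → 0 < i → i < j → f j i ≡ 0ℤ) →
               ∀ {n} d → ∏< (d + suc n) f n ≡ ∏∞ f n
∏∞-converges f unit ord         zero    = refl
∏∞-converges f unit ord {n = n} (suc d) = trans
  (*ₚ-trivialʳ (∏< (d + suc n) f) (f (d + suc n)) n
    (unit (≤-trans z<s n<d+1+n))
    (λ 0<i i≤n → ord 0<i (≤-<-trans i≤n n<d+1+n)))
  (∏∞-converges f unit ord d)
  where
  n<d+1+n : n < d + suc n
  n<d+1+n = m≤n+m (suc n) d

------------------------------------------------------------------------
-- The families above satisfy the hypotheses of those lemmas

q^-other : ∀ {a n} → n ≢ a → (q^ a) n ≡ 0ℤ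
q^-other {a} {n} n≢a = cong (if_then 1ℤ else 0ℤ) (dec-false (n ≟ a) n≢a)

1-q^-constant : ∀ {a} → 0 < a → (1ₚ -ₚ q^ a) 0 ≡ 1ℤ
1-q^-constant (s≤s _) = refl

1-q^-low : ∀ {a n} → 0 < n → n < a → (1ₚ -ₚ q^ a) n ≡ 0ℤ
1-q^-low (s≤s _) n<a = cong (λ x → 0ℤ ℤ.- x) (q^-other (<⇒≢ n<a))

*ₚ-constant : ∀ F G → F 0 ≡ 1ℤ → G 0 ≡ 1ℤ → (F *ₚ G) 0 ≡ 1ℤ
*ₚ-constant F G F₀≡1 G₀≡1 = cong₂ (λ x y → x ℤ.* y ℤ.+ 0ℤ) F₀≡1 G₀≡1

qPochhammer-converges : ∀ {a b} → 0 < a → 0 < b → ∀ {n} d →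
  ∏< (d + suc n) (λ j → 1ₚ -ₚ q^ (a + b * j)) n ≡ ⟨q^ a ⨾q^ b ⟩∞ n
qPochhammer-converges {a} {b} 0<a 0<b =
  ∏∞-converges (λ j → 1ₚ -ₚ q^ (a + b * j))
    (λ _ → 1-q^-constant (≤-trans 0<a (m≤m+n a _)))
    (λ {j} 0<i i<j → 1-q^-low 0<i
      (<-≤-trans i<j (≤-trans (m≤n*m j b {{>-nonZero 0<b}}) (m≤n+m (b * j) a))))

qPochhammer-constant : ∀ {a b} → 0 < a → ⟨q^ a ⨾q^ b ⟩∞ 0 ≡ 1ℤ
qPochhammer-constant {a} {b} 0<a =
  *ₚ-constant 1ₚ (1ₚ -ₚ q^ (a + b * 0)) refl (1-q^-constant (≤-trans 0<a (m≤m+n a _)))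

2∣j²+[2k+1]j : ∀ k j → 2 ∣ j ^ 2 + (2 * k + 1) * j
2∣j²+[2k+1]j k zero    = subst (2 ∣_) (sym (*-zeroʳ (2 * k + 1))) (2 ∣0)
2∣j²+[2k+1]j k (suc j) = subst (2 ∣_) (step k j)
  (∣m∣n⇒∣m+n (2∣j²+[2k+1]j k j) (m∣m*n (j + 1 + k)))
  where
  open +-*-Solver
  step : ∀ k j → j ^ 2 + (2 * k + 1) * j + 2 * (j + 1 + k) ≡ suc j ^ 2 + (2 * k + 1) * suc j
  step = solve 2 (λ k j →
    j :^ 2 :+ (con 2 :* k :+ con 1) :* j :+ con 2 :* (j :+ con 1 :+ k) :=
    (con 1 :+ j) :^ 2 :+ (con 2 :* k :+ con 1) :* (con 1 :+ j)) refl

j+sj≤half : ∀ r s k j → 2 * s < r → j + s * j ≤ r * (j ^ 2 + (2 * k + 1) * j) / 2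
j+sj≤half r s k zero      2s<r = subst (_≤ r * (0 ^ 2 + (2 * k + 1) * 0) / 2) (sym (*-zeroʳ s)) z≤n
j+sj≤half r s k j@(suc i) 2s<r = begin
  j + s * j                                     ≡⟨ m*n/n≡m (suc s * j) 2 ⟨
  suc s * j * 2 / 2                             ≤⟨ /-monoˡ-≤ 2 (*-monoˡ-≤ 2 (*-monoˡ-≤ j 1+s≤r)) ⟩
  r * j * 2 / 2                                 ≤⟨ /-monoˡ-≤ 2 (m≤m+n (r * j * 2) (r * j * (i + 2 * k))) ⟩
  (r * j * 2 + r * j * (i + 2 * k)) / 2         ≡⟨ cong (_/ 2) (step r i k) ⟩
  r * (j ^ 2 + (2 * k + 1) * j) / 2             ∎
  where
  open ≤-Reasoning
  1+s≤r : suc s ≤ r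
  1+s≤r = ≤-trans (s≤s (m≤m+n s _)) 2s<r
  open +-*-Solver
  step : ∀ r i k → r * suc i * 2 + r * suc i * (i + 2 * k) ≡ r * (suc i ^ 2 + (2 * k + 1) * suc i)
  step = solve 3 (λ r i k →
    r :* (con 1 :+ i) :* con 2 :+ r :* (con 1 :+ i) :* (i :+ con 2 :* k) :=
    r :* ((con 1 :+ i) :^ 2 :+ (con 2 :* k :+ con 1) :* (con 1 :+ i))) refl

exponent-exact : ∀ r s k j → 2 * s < r →
  2 * (exponent r s k j + s * j) ≡ r * (j ^ 2 + (2 * k + 1) * j)
exponent-exact r s k j 2s<r = begin
  2 * (exponent r s k j + s * j)         ≡⟨ cong (2 *_) (m∸n+n≡m (≤-trans (m≤n+m (s * j) j) (j+sj≤half r s k j 2s<r))) ⟩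
  2 * (r * (j ^ 2 + (2 * k + 1) * j) / 2) ≡⟨ *-comm 2 (r * (j ^ 2 + (2 * k + 1) * j) / 2) ⟩
  r * (j ^ 2 + (2 * k + 1) * j) / 2 * 2   ≡⟨ m/n*n≡m (∣-trans (2∣j²+[2k+1]j k j) (n∣m*n r)) ⟩
  r * (j ^ 2 + (2 * k + 1) * j)           ∎
  where open ≡-Reasoning

exponent-≥ : ∀ r s k j → 2 * s < r → j ≤ exponent r s k j
exponent-≥ r s k j 2s<r = m+n≤o⇒m≤o∸n j (j+sj≤half r s k j 2s<r)

j[j+1] : ∀ j → j * (j + 1) ≡ j ^ 2 + (2 * 0 + 1) * j
j[j+1] = solve 1 (λ j → j :* (j :+ con 1) := j :^ 2 :+ (con 0 :+ con 1) :* j) refl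
  where open +-*-Solver

tailExponent-exact : ∀ r s j → 2 * s < r →
  2 * (r * (j * (j + 1)) / 2) ≡ r * (j * (j + 1)) × j + s * j ≤ r * (j * (j + 1)) / 2
tailExponent-exact r s j 2s<r rewrite j[j+1] j =
  trans (*-comm 2 (r * (j ^ 2 + (2 * 0 + 1) * j) / 2)) (m/n*n≡m (∣-trans (2∣j²+[2k+1]j 0 j) (n∣m*n r))) , j+sj≤half r s 0 j 2s<r

numeratorTerm-order : ∀ r s k → 2 * s < r → ∀ {j n} → n < j → numeratorTerm r s k j n ≡ 0ℤ
numeratorTerm-order r s k 2s<r {j} {n} n<j = trans
  (cong (λ x → (-1ℤ ℤ.^ j) ℤ.* x)
    (*ₚ-lowˡ (q^ (exponent r s k j)) (1ₚ -ₚ q^ (2 * j * s + (2 * k + 1) * s)) n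
      (λ i≤n → q^-other (<⇒≢ (≤-<-trans i≤n (<-≤-trans n<j (exponent-≥ r s k j 2s<r)))))))
  (ℤ.*-zeroʳ (-1ℤ ℤ.^ j))

tailTerm-order : ∀ r s → 2 * s < r → ∀ {j n} → n < j → tailTerm r s j n ≡ 0ℤ
tailTerm-order r s 2s<r {j} {n} n<j with tailExponent-exact r s j 2s<r
... | _ , low = trans
  (cong (λ x → (-1ℤ ℤ.^ j) ℤ.* x)
    (cong₂ ℤ._-_
      (q^-other (<⇒≢ (<-≤-trans n<j (m+n≤o⇒m≤o∸n j low))))
      (q^-other (<⇒≢ (<-≤-trans n<j (≤-trans (≤-trans (m≤m+n j (s * j)) low) (m≤m+n (r * (j * (j + 1)) / 2) ((j + 1) * s))))))))
  (ℤ.*-zeroʳ (-1ℤ ℤ.^ j))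

numerator-converges : ∀ r s k → 2 * s < r → ∀ {n m} → n < m →
  ∑[ j < m ] numeratorTerm r s k (toℕ j) n ≡ numerator r s k n
numerator-converges r s k 2s<r = ∑∞-converges (numeratorTerm r s k) (numeratorTerm-order r s k 2s<r)

tailSum-converges : ∀ r s k → 2 * s < r → ∀ {n m} → n < m →
  ∑[ i < m ] tailTerm r s (k + toℕ i) n ≡ tailSum r s k n
tailSum-converges r s k 2s<r =
  ∑∞-converges (λ i → tailTerm r s (k + i)) (λ {i} n<i → tailTerm-order r s 2s<r (<-≤-trans n<i (m≤n+m i k)))

{-# OPTIONS --safe #-}

-- Put u = r - s and v = r + s or v = 2r - s; these are coprime, and with
-- D = uv the coefficients R(n) of 1 / ((1 - q^u)(1 - q^v)) satisfy
-- |D R(n) - n| ≤ D.  Pair the numerator terms j = 2i and j = 2i + 1: with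
-- m = k + 2i, x = (2m + 1)s and y = r(m + 1) - s such a pair is a power of q
-- times
--   1 - q^x - q^y + q^(x+y+2s) = (1 - q^x)(1 - q^y) - q^(x+y) (1 - q^(2s)).
-- After division by the denominator, the first product contributes a
-- nonnegative series, which has gained about (2m + 1) y / D by degree x + y;
-- the second contributes a loss that starts there and grows with slope about
-- 2 / D.  As k ≥ 8r + 4, the gain of each pair exceeds everything that it and
-- its predecessors lose before the pair after the next sets in.
--
-- The tail series, up to sign, is a power of q times the numerator, and its
-- denominator contains the three factors treated above; the other factors
-- 1 / (1 - q^a) have nonnegative coefficients.

module Submission where

open import Defs
open import Algebra.Bundles using (CommutativeRing)
import Algebra.Solver.Ring
open import Algebra.Solver.Ring.AlmostCommutativeRing using (fromCommutativeRing; _-Raw-AlmostCommutative⟶_)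
open import Data.Bool.Base using (true; false; if_then_else_)
open import Data.Fin.Base using (toℕ)
open import Data.Integer.Base as ℤ using (ℤ; +_; 0ℤ; 1ℤ; -1ℤ; +≤+) renaming (_^_ to _^ℤ_)
import Data.Integer.Properties as ℤ
import Data.Integer.Tactic.RingSolver as ℤ-Solver
open import Algebra.Properties.Monoid.Sum ℤ.+-0-monoid using (sum-syntax; sum-cong-≗)
open import Data.Maybe.Base using (Maybe; just; nothing)
open import Data.Nat.Base using (ℕ; zero; suc; _+_; _*_; _∸_; _^_; _≤_; _<_; z≤n; s≤s; z<s; NonZero; >-nonZero)
open import Data.Nat.Coprimality using (Coprime; coprime-divisor; coprime-Bézout; coprime-factors)
open import Data.Nat.Divisibility
open import Data.Nat.DivMod using (_%_; m≡m%n+[m/n]*n; m%n<n) renaming (_/_ to _/ℕ_)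
open import Data.Nat.GCD using (module Bézout)
open import Data.Nat.Induction using (<-rec)
open import Data.Nat.Properties
import Data.Nat.Tactic.RingSolver as ℕ-Solver
open import Data.Product.Base using (_×_; _,_; ∃; proj₁; proj₂)
open import Data.Rational.Unnormalised.Base using (_/_; _>_; *<*)
open import Data.Rational.Unnormalised.Properties using (↥[n/d]≡n; ↧[n/d]≡d)
open import Data.Sum.Base using (_⊎_; inj₁; inj₂)
open import Function.Base using (_∘_)
open import Relation.Binary.PropositionalEquality
open import Relation.Nullary using (yes; no; does; contradiction)
open import Relation.Nullary.Decidable using (dec-true; dec-false)

-- The ring of power series

infixl 6 _+ₚ_
infix  8 -ₚ_

_+ₚ_ : PowerSeries → PowerSeries → PowerSeries
(F +ₚ G) n = F n ℤ.+ G n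

-ₚ_ : PowerSeries → PowerSeries
(-ₚ F) n = ℤ.- F n

0ₚ : PowerSeries
0ₚ _ = 0ℤ

_≐[_]_ : PowerSeries → ℕ → PowerSeries → Set
F ≐[ n ] G = ∀ {i} → i ≤ n → F i ≡ G i

-- Only coefficients up to `n` enter coefficient `n` of a product; this is what later allows
-- infinite sums and products to be replaced by truncations.
*ₚ-local : ∀ n {F F′ G G′} → F ≐[ n ] F′ → G ≐[ n ] G′ → (F *ₚ G) n ≡ (F′ *ₚ G′) n
*ₚ-local zero    F≐ G≐ = cong₂ (λ x y → x ℤ.* y ℤ.+ 0ℤ) (F≐ z≤n) (G≐ z≤n)
*ₚ-local (suc n) F≐ G≐ = cong₂ ℤ._+_
  (cong₂ ℤ._*_ (F≐ z≤n) (G≐ ≤-refl))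
  (*ₚ-local n (F≐ ∘ s≤s) (G≐ ∘ m≤n⇒m≤1+n))

*ₚ-cong : ∀ {F F′ G G′} → F ≗ F′ → G ≗ G′ → F *ₚ G ≗ F′ *ₚ G′
*ₚ-cong F≗ G≗ n = *ₚ-local n (λ {i} _ → F≗ i) (λ {i} _ → G≗ i)

*ₚ-distribʳ : ∀ H F G → (F +ₚ G) *ₚ H ≗ F *ₚ H +ₚ G *ₚ H
*ₚ-distribʳ H F G zero    = lemma (F 0) (G 0) (H 0)
  where
  lemma : ∀ a b c → (a ℤ.+ b) ℤ.* c ℤ.+ 0ℤ ≡ (a ℤ.* c ℤ.+ 0ℤ) ℤ.+ (b ℤ.* c ℤ.+ 0ℤ)
  lemma = ℤ-Solver.solve-∀
*ₚ-distribʳ H F G (suc n) = trans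
  (cong (λ x → (F 0 ℤ.+ G 0) ℤ.* H (suc n) ℤ.+ x) (*ₚ-distribʳ H (F ∘ suc) (G ∘ suc) n))
  (lemma (F 0) (G 0) (H (suc n)) ((F ∘ suc *ₚ H) n) ((G ∘ suc *ₚ H) n))
  where
  lemma : ∀ a b c x y → (a ℤ.+ b) ℤ.* c ℤ.+ (x ℤ.+ y) ≡ (a ℤ.* c ℤ.+ x) ℤ.+ (b ℤ.* c ℤ.+ y)
  lemma = ℤ-Solver.solve-∀

·-*ₚ : ∀ c F G → (c · F) *ₚ G ≗ c · (F *ₚ G)
·-*ₚ c F G zero    = lemma c (F 0) (G 0)
  where
  lemma : ∀ c a b → (c ℤ.* a) ℤ.* b ℤ.+ 0ℤ ≡ c ℤ.* (a ℤ.* b ℤ.+ 0ℤ)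
  lemma = ℤ-Solver.solve-∀
·-*ₚ c F G (suc n) = trans
  (cong (λ x → (c ℤ.* F 0) ℤ.* G (suc n) ℤ.+ x) (·-*ₚ c (F ∘ suc) G n))
  (lemma c (F 0) (G (suc n)) ((F ∘ suc *ₚ G) n))
  where
  lemma : ∀ c a b x → (c ℤ.* a) ℤ.* b ℤ.+ c ℤ.* x ≡ c ℤ.* (a ℤ.* b ℤ.+ x)
  lemma = ℤ-Solver.solve-∀

-- The product unfolds by splitting off the first coefficient of `F`. Splitting off the last one
-- instead gives the mirrored recursion from which commutativity follows.
*ₚ-suc : ∀ F G n → (F *ₚ G) (suc n) ≡ (F *ₚ (G ∘ suc)) n ℤ.+ F (suc n) ℤ.* G 0
*ₚ-suc F G zero    = lemma (F 0) (F 1) (G 0) (G 1)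
  where
  lemma : ∀ f f′ g g′ → f ℤ.* g′ ℤ.+ (f′ ℤ.* g ℤ.+ 0ℤ) ≡ (f ℤ.* g′ ℤ.+ 0ℤ) ℤ.+ f′ ℤ.* g
  lemma = ℤ-Solver.solve-∀
*ₚ-suc F G (suc n) = trans
  (cong (λ x → F 0 ℤ.* G (suc (suc n)) ℤ.+ x) (*ₚ-suc (F ∘ suc) G n))
  (sym (ℤ.+-assoc (F 0 ℤ.* G (suc (suc n))) ((F ∘ suc *ₚ G ∘ suc) n) (F (suc (suc n)) ℤ.* G 0)))

*ₚ-comm : ∀ F G → F *ₚ G ≗ G *ₚ F
*ₚ-comm F G zero    = cong (ℤ._+ 0ℤ) (ℤ.*-comm (F 0) (G 0))
*ₚ-comm F G (suc n) = trans
  (cong₂ ℤ._+_ (ℤ.*-comm (F 0) (G (suc n))) (*ₚ-comm (F ∘ suc) G n))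
  (trans (ℤ.+-comm (G (suc n) ℤ.* F 0) ((G *ₚ F ∘ suc) n)) (sym (*ₚ-suc G F n)))

*ₚ-assoc : ∀ F G H → (F *ₚ G) *ₚ H ≗ F *ₚ (G *ₚ H)
*ₚ-assoc F G H zero    = lemma (F 0) (G 0) (H 0)
  where
  lemma : ∀ a b c → (a ℤ.* b ℤ.+ 0ℤ) ℤ.* c ℤ.+ 0ℤ ≡ a ℤ.* (b ℤ.* c ℤ.+ 0ℤ) ℤ.+ 0ℤ
  lemma = ℤ-Solver.solve-∀
*ₚ-assoc F G H (suc n) = begin
  -- By definition, `(F *ₚ G) ∘ suc` is `(F 0 · (G ∘ suc)) +ₚ (F ∘ suc *ₚ G)`.
  ab ℤ.* H (suc n) ℤ.+ (((F 0 · (G ∘ suc)) +ₚ (F ∘ suc *ₚ G)) *ₚ H) n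
    ≡⟨ cong (λ x → ab ℤ.* H (suc n) ℤ.+ x) (*ₚ-distribʳ H (F 0 · (G ∘ suc)) (F ∘ suc *ₚ G) n) ⟩
  ab ℤ.* H (suc n) ℤ.+ (((F 0 · (G ∘ suc)) *ₚ H) n ℤ.+ ((F ∘ suc *ₚ G) *ₚ H) n)
    ≡⟨ cong₂ (λ x y → ab ℤ.* H (suc n) ℤ.+ (x ℤ.+ y)) (·-*ₚ (F 0) (G ∘ suc) H n) (*ₚ-assoc (F ∘ suc) G H n) ⟩
  ab ℤ.* H (suc n) ℤ.+ (F 0 ℤ.* (G ∘ suc *ₚ H) n ℤ.+ (F ∘ suc *ₚ (G *ₚ H)) n)
    ≡⟨ lemma (F 0) (G 0) (H (suc n)) ((G ∘ suc *ₚ H) n) ((F ∘ suc *ₚ (G *ₚ H)) n) ⟩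
  F 0 ℤ.* (G 0 ℤ.* H (suc n) ℤ.+ (G ∘ suc *ₚ H) n) ℤ.+ (F ∘ suc *ₚ (G *ₚ H)) n ∎
  where
  open ≡-Reasoning
  ab : ℤ
  ab = F 0 ℤ.* G 0 ℤ.+ 0ℤ
  lemma : ∀ a b c x y → (a ℤ.* b ℤ.+ 0ℤ) ℤ.* c ℤ.+ (a ℤ.* x ℤ.+ y) ≡ a ℤ.* (b ℤ.* c ℤ.+ x) ℤ.+ y
  lemma = ℤ-Solver.solve-∀

*ₚ-identityʳ : ∀ F → F *ₚ 1ₚ ≗ F
*ₚ-identityʳ F n = *ₚ-trivialʳ F 1ₚ n refl λ { (s≤s _) _ → refl }

powerSeriesRing : CommutativeRing _ _
powerSeriesRing = record
  { Carrier = PowerSeries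
  ; _≈_ = _≗_
  ; _+_ = _+ₚ_
  ; _*_ = _*ₚ_
  ; -_ = -ₚ_
  ; 0# = 0ₚ
  ; 1# = 1ₚ
  ; isCommutativeRing = record
    { isRing = record
      { +-isAbelianGroup = record
        { isGroup = record
          { isMonoid = record
            { isSemigroup = record
              { isMagma = record
                { isEquivalence = record
                  { refl = λ _ → refl
                  ; sym = λ p n → sym (p n)
                  ; trans = λ p q n → trans (p n) (q n)
                  }
                ; ∙-cong = λ p q n → cong₂ ℤ._+_ (p n) (q n)
                }
              ; assoc = λ F G H n → ℤ.+-assoc (F n) (G n) (H n)
              }
            ; identity = (λ F n → ℤ.+-identityˡ (F n)) , (λ F n → ℤ.+-identityʳ (F n))
            }
          ; inverse = (λ F n → ℤ.+-inverseˡ (F n)) , (λ F n → ℤ.+-inverseʳ (F n))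
          ; ⁻¹-cong = λ p n → cong ℤ.-_ (p n)
          }
        ; comm = λ F G n → ℤ.+-comm (F n) (G n)
        }
      ; *-cong = *ₚ-cong
      ; *-assoc = *ₚ-assoc
      ; *-identity = (λ F n → trans (*ₚ-comm 1ₚ F n) (*ₚ-identityʳ F n)) , *ₚ-identityʳ
      ; distrib = (λ H F G n → trans (*ₚ-comm H (F +ₚ G) n)
                    (trans (*ₚ-distribʳ H F G n) (cong₂ ℤ._+_ (*ₚ-comm F H n) (*ₚ-comm G H n))))
                , *ₚ-distribʳ
      }
    ; *-comm = *ₚ-comm
    }
  }

open CommutativeRing powerSeriesRing
  using (+-congʳ; *-congʳ; *-congˡ; zeroʳ; distribˡ)
  renaming (*-identityˡ to *ₚ-identityˡ; refl to ≗-refl; sym to ≗-sym; trans to ≗-trans)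

module ≗-Reasoning where
  open import Relation.Binary.Reasoning.Setoid (CommutativeRing.setoid powerSeriesRing) public

-- The first two clauses make con 0ℤ and con 1ℤ denote 0ₚ and 1ₚ themselves.
constant : ℤ → PowerSeries
constant (+ 0) = 0ₚ
constant (+ 1) = 1ₚ
constant c     = c · 1ₚ

constant≗ : ∀ c → constant c ≗ c · 1ₚ
constant≗ (+ 0)             n = sym (ℤ.*-zeroˡ (1ₚ n))
constant≗ (+ 1)             n = sym (ℤ.*-identityˡ (1ₚ n))
constant≗ (+ suc (suc _))   n = refl
constant≗ (ℤ.-[1+ _ ])      n = refl

constant-weaklyDec : ∀ a b → Maybe (constant a ≗ constant b)
constant-weaklyDec a b with a ℤ.≟ b
... | yes a≡b = just λ n → cong (λ c → constant c n) a≡b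
... | no  _   = nothing

constant-homomorphism : ℤ.+-*-rawRing -Raw-AlmostCommutative⟶ fromCommutativeRing powerSeriesRing
constant-homomorphism = record
  { ⟦_⟧    = constant
  ; +-homo = λ a b n → trans (constant≗ (a ℤ.+ b) n)
      (trans (ℤ.*-distribʳ-+ (1ₚ n) a b) (sym (cong₂ ℤ._+_ (constant≗ a n) (constant≗ b n))))
  ; *-homo = λ a b n → trans (constant≗ (a ℤ.* b) n)
      (trans (ℤ.*-assoc a b (1ₚ n))
        (sym (trans (*ₚ-cong (constant≗ a) (constant≗ b) n)
          (trans (·-*ₚ a 1ₚ (b · 1ₚ) n)
            (cong (a ℤ.*_) (*ₚ-identityˡ (b · 1ₚ) n))))))
  ; -‿homo = λ a n → trans (constant≗ (ℤ.- a) n)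
      (trans (sym (ℤ.neg-distribˡ-* a (1ₚ n))) (sym (cong ℤ.-_ (constant≗ a n))))
  ; 0-homo = λ _ → refl
  ; 1-homo = λ _ → refl
  }

module ₚ-Solver = Algebra.Solver.Ring ℤ.+-*-rawRing (fromCommutativeRing powerSeriesRing)
  constant-homomorphism constant-weaklyDec

open ₚ-Solver using (solve; _:=_; _:+_; _:*_; _:-_; con)

-- Quotients

-- The induction follows the long division: `X 0` is forced to be `F 0`, and `X ∘ suc` multiplied by
-- `G` is the remainder that is divided next.
quotient-unique : ∀ X F G → G 0 ≡ 1ℤ → X *ₚ G ≗ F → X ≗ F /ₚ G
quotient-unique X F G G₀≡1 XG≗F zero = begin
  X 0                 ≡⟨ ℤ.*-identityʳ (X 0) ⟨
  X 0 ℤ.* 1ℤ          ≡⟨ cong (X 0 ℤ.*_) G₀≡1 ⟨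
  X 0 ℤ.* G 0         ≡⟨ ℤ.+-identityʳ (X 0 ℤ.* G 0) ⟨
  X 0 ℤ.* G 0 ℤ.+ 0ℤ  ≡⟨ XG≗F 0 ⟩
  F 0                 ∎
  where open ≡-Reasoning
quotient-unique X F G G₀≡1 XG≗F (suc n) =
  quotient-unique (X ∘ suc) (λ m → F (suc m) ℤ.- F 0 ℤ.* G (suc m)) G G₀≡1 remainder n
  where
  lemma : ∀ a b → b ≡ (a ℤ.+ b) ℤ.- a
  lemma = ℤ-Solver.solve-∀
  remainder : ∀ m → (X ∘ suc *ₚ G) m ≡ F (suc m) ℤ.- F 0 ℤ.* G (suc m)
  remainder m = trans (lemma (X 0 ℤ.* G (suc m)) ((X ∘ suc *ₚ G) m))
    (cong₂ (λ y x → y ℤ.- x ℤ.* G (suc m)) (XG≗F (suc m)) (quotient-unique X F G G₀≡1 XG≗F 0))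

/ₚ-local : ∀ n {F F′ G G′} → F ≐[ n ] F′ → G ≐[ n ] G′ → (F /ₚ G) n ≡ (F′ /ₚ G′) n
/ₚ-local zero    F≐ G≐ = F≐ z≤n
/ₚ-local (suc n) F≐ G≐ = /ₚ-local n
  (λ i≤n → cong₂ ℤ._-_ (F≐ (s≤s i≤n)) (cong₂ ℤ._*_ (F≐ z≤n) (G≐ (s≤s i≤n))))
  (G≐ ∘ m≤n⇒m≤1+n)

*ₚ-/ₚ : ∀ H F G → G 0 ≡ 1ℤ → H *ₚ (F /ₚ G) ≗ (H *ₚ F) /ₚ G
*ₚ-/ₚ H F G G₀≡1 = quotient-unique (H *ₚ (F /ₚ G)) (H *ₚ F) G G₀≡1
  (≗-trans (*ₚ-assoc H (F /ₚ G) G) (*-congˡ {H} (/ₚ-*ₚ F G G₀≡1)))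

·-/ₚ : ∀ c F G → G 0 ≡ 1ℤ → c · (F /ₚ G) ≗ (c · F) /ₚ G
·-/ₚ c F G G₀≡1 = quotient-unique (c · (F /ₚ G)) (c · F) G G₀≡1
  (λ n → trans (·-*ₚ c (F /ₚ G) G n) (cong (c ℤ.*_) (/ₚ-*ₚ F G G₀≡1 n)))

-- Turns division by a further factor into multiplication by its inverse, under which nonnegativity
-- is easy to track.
/ₚ-*ₚ-unit : ∀ F {G A B} → G 0 ≡ 1ℤ → A 0 ≡ 1ℤ → B *ₚ A ≗ 1ₚ → (F /ₚ G) *ₚ B ≗ F /ₚ (G *ₚ A)
/ₚ-*ₚ-unit F {G} {A} {B} G₀≡1 A₀≡1 BA≗1 =
  quotient-unique ((F /ₚ G) *ₚ B) F (G *ₚ A) (*ₚ-constant G A G₀≡1 A₀≡1) (begin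
    ((F /ₚ G) *ₚ B) *ₚ (G *ₚ A)
      ≈⟨ solve 4 (λ f b g a → (f :* b) :* (g :* a) := (f :* g) :* (b :* a)) ≗-refl (F /ₚ G) B G A ⟩
    ((F /ₚ G) *ₚ G) *ₚ (B *ₚ A)  ≈⟨ *ₚ-cong (/ₚ-*ₚ F G G₀≡1) BA≗1 ⟩
    F *ₚ 1ₚ                      ≈⟨ *ₚ-identityʳ F ⟩
    F                            ∎)
  where open ≗-Reasoning

-- Nonnegative series

*-nonneg : ∀ {a b} → 0ℤ ℤ.≤ a → 0ℤ ℤ.≤ b → 0ℤ ℤ.≤ a ℤ.* b
*-nonneg {+ m} {+ n} _ _ = subst (0ℤ ℤ.≤_) (ℤ.pos-* m n) (+≤+ z≤n)

*ₚ-nonneg : ∀ {F G} → Nonnegative F → Nonnegative G → Nonnegative (F *ₚ G)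
*ₚ-nonneg 0≤F 0≤G zero    = ℤ.+-mono-≤ (*-nonneg (0≤F 0) (0≤G 0)) ℤ.≤-refl
*ₚ-nonneg 0≤F 0≤G (suc n) = ℤ.+-mono-≤ (*-nonneg (0≤F 0) (0≤G (suc n))) (*ₚ-nonneg (0≤F ∘ suc) 0≤G n)

q^-nonneg : ∀ a → Nonnegative (q^ a)
q^-nonneg a n with does (n ≟ a)
... | true   = +≤+ z≤n
... | false = +≤+ z≤n

-- Multiplication by a power of q

q^-*ₚ-< : ∀ a F {n} → n < a → (q^ a *ₚ F) n ≡ 0ℤ
q^-*ₚ-< a F {n} n<a = *ₚ-lowˡ (q^ a) F n (λ i≤n → q^-other (<⇒≢ (≤-<-trans i≤n n<a)))

q^-*ₚ-+ : ∀ a F n → (q^ a *ₚ F) (a + n) ≡ F n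
q^-*ₚ-+ zero    F n = *ₚ-identityˡ F n
q^-*ₚ-+ (suc a) F n = trans
  (cong (ℤ._+ (q^ a *ₚ F) (a + n)) (ℤ.*-zeroˡ (F (suc (a + n)))))
  (trans (ℤ.+-identityˡ ((q^ a *ₚ F) (a + n))) (q^-*ₚ-+ a F n))

q^-+-+ : ∀ a b n → (q^ (a + b)) (a + n) ≡ (q^ b) n
q^-+-+ zero    b n = refl
q^-+-+ (suc a) b n = q^-+-+ a b n

<-or-+ : ∀ a n → n < a ⊎ ∃ λ n′ → n ≡ a + n′
<-or-+ a n with <-≤-connex n a
... | inj₁ n<a = inj₁ n<a
... | inj₂ a≤n = inj₂ (n ∸ a , sym (m+[n∸m]≡n a≤n))

q^-+ : ∀ a b → q^ (a + b) ≗ q^ a *ₚ q^ b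
q^-+ a b n with <-or-+ a n
... | inj₁ n<a         = trans (q^-other (<⇒≢ (<-≤-trans n<a (m≤m+n a b)))) (sym (q^-*ₚ-< a (q^ b) n<a))
... | inj₂ (n′ , refl) = trans (q^-+-+ a b n′) (sym (q^-*ₚ-+ a (q^ b) n′))

-- The series 1 / (1 - q^a)

multiples : ℕ → PowerSeries
multiples a n = if does (a ∣? n) then 1ℤ else 0ℤ

multiples-∣ : ∀ {a n} → a ∣ n → multiples a n ≡ 1ℤ
multiples-∣ {a} {n} a∣n = cong (if_then 1ℤ else 0ℤ) (dec-true (a ∣? n) a∣n)

multiples-∤ : ∀ {a n} → a ∤ n → multiples a n ≡ 0ℤ
multiples-∤ {a} {n} a∤n = cong (if_then 1ℤ else 0ℤ) (dec-false (a ∣? n) a∤n)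

multiples-nonneg : ∀ a → Nonnegative (multiples a)
multiples-nonneg a n with a ∣? n
... | yes _ = +≤+ z≤n
... | no  _ = +≤+ z≤n

multiples-+ : ∀ a n → multiples a (a + n) ≡ multiples a n
multiples-+ a n with a ∣? n
... | yes a∣n = multiples-∣ (∣m∣n⇒∣m+n ∣-refl a∣n)
... | no  a∤n = multiples-∤ (λ a∣a+n → a∤n (∣m+n∣m⇒∣n a∣a+n ∣-refl))

multiples-inverse : ∀ {a} → 0 < a → multiples a *ₚ (1ₚ -ₚ q^ a) ≗ 1ₚ
multiples-inverse {a} 0<a n = trans
  (solve 2 (λ m x → m :* (con 1ℤ :- x) := m :- x :* m) ≗-refl (multiples a) (q^ a) n) (coefficient n)
  where
  coefficient : ∀ n → multiples a n ℤ.- (q^ a *ₚ multiples a) n ≡ 1ₚ n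
  coefficient n with <-or-+ a n
  ... | inj₁ n<a = trans (cong₂ ℤ._-_ (below n n<a) (q^-*ₚ-< a (multiples a) n<a)) (ℤ.+-identityʳ (1ₚ n))
    where
    below : ∀ n → n < a → multiples a n ≡ 1ₚ n
    below zero    _   = multiples-∣ (a ∣0)
    below (suc n) n<a = multiples-∤ (>⇒∤ n<a)
  ... | inj₂ (n′ , refl) = begin
    multiples a (a + n′) ℤ.- (q^ a *ₚ multiples a) (a + n′)
      ≡⟨ cong₂ ℤ._-_ (multiples-+ a n′) (q^-*ₚ-+ a (multiples a) n′) ⟩
    multiples a n′ ℤ.- multiples a n′  ≡⟨ ℤ.+-inverseʳ (multiples a n′) ⟩
    0ℤ                                 ≡⟨ q^-other (>⇒≢ (<-≤-trans 0<a (m≤m+n a n′))) ⟨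
    1ₚ (a + n′)                        ∎
    where open ≡-Reasoning

-- This is `F (1 + q^s + ⋯ + q^((c-1)s))`, the quotient of `(1 - q^(cs)) F` by `1 - q^s`, in a form
-- that shows its sign.
geometric : ℕ → ℕ → PowerSeries → PowerSeries
geometric s zero    F = 0ₚ
geometric s (suc c) F = geometric s c F +ₚ q^ (c * s) *ₚ F

geometric-*ₚ : ∀ s c F → geometric s c F *ₚ (1ₚ -ₚ q^ s) ≗ (1ₚ -ₚ q^ (c * s)) *ₚ F
geometric-*ₚ s zero    F = solve 2 (λ x f → con 0ℤ :* x := (con 1ℤ :- con 1ℤ) :* f) ≗-refl (1ₚ -ₚ q^ s) F
geometric-*ₚ s (suc c) F = begin
  (geometric s c F +ₚ q^ (c * s) *ₚ F) *ₚ (1ₚ -ₚ q^ s)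
    ≈⟨ solve 4 (λ g x f y → (g :+ x :* f) :* (con 1ℤ :- y) := g :* (con 1ℤ :- y) :+ (x :* f :- y :* x :* f))
         ≗-refl (geometric s c F) (q^ (c * s)) F (q^ s) ⟩
  geometric s c F *ₚ (1ₚ -ₚ q^ s) +ₚ (q^ (c * s) *ₚ F -ₚ q^ s *ₚ q^ (c * s) *ₚ F)
    ≈⟨ +-congʳ (geometric-*ₚ s c F) ⟩
  (1ₚ -ₚ q^ (c * s)) *ₚ F +ₚ (q^ (c * s) *ₚ F -ₚ q^ s *ₚ q^ (c * s) *ₚ F)
    ≈⟨ solve 3 (λ x f y → (con 1ℤ :- x) :* f :+ (x :* f :- y :* x :* f) := (con 1ℤ :- y :* x) :* f)
         ≗-refl (q^ (c * s)) F (q^ s) ⟩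
  (1ₚ -ₚ q^ s *ₚ q^ (c * s)) *ₚ F
    ≈⟨ *-congʳ (λ n → cong (λ x → 1ₚ n ℤ.- x) (q^-+ s (c * s) n)) ⟨
  (1ₚ -ₚ q^ (suc c * s)) *ₚ F ∎
  where open ≗-Reasoning

geometric-nonneg : ∀ s c {F} → Nonnegative F → Nonnegative (geometric s c F)
geometric-nonneg s zero    0≤F n = ℤ.≤-refl
geometric-nonneg s (suc c) 0≤F n =
  ℤ.+-mono-≤ (geometric-nonneg s c 0≤F n) (*ₚ-nonneg (q^-nonneg (c * s)) 0≤F n)

geometric-≥-summand : ∀ s c {F} → Nonnegative F → ∀ {j} → j < c → ∀ n →
                      (q^ (j * s) *ₚ F) n ℤ.≤ geometric s c F n
geometric-≥-summand s (suc c) {F} 0≤F {j} j<1+c n with m<1+n⇒m<n∨m≡n j<1+c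
... | inj₁ j<c  = ℤ.≤-trans (ℤ.≤-reflexive (sym (ℤ.+-identityʳ ((q^ (j * s) *ₚ F) n))))
  (ℤ.+-mono-≤ (geometric-≥-summand s c 0≤F j<c n) (*ₚ-nonneg (q^-nonneg (c * s)) 0≤F n))
... | inj₂ refl = ℤ.≤-trans (ℤ.≤-reflexive (sym (ℤ.+-identityˡ ((q^ (j * s) *ₚ F) n))))
  (ℤ.+-monoˡ-≤ ((q^ (j * s) *ₚ F) n) (geometric-nonneg s c 0≤F n))

geometric-zero : ∀ s c F n → (∀ {j} → j < c → (q^ (j * s) *ₚ F) n ≡ 0ℤ) → geometric s c F n ≡ 0ℤ
geometric-zero s zero    F n _  = refl
geometric-zero s (suc c) F n ≡0 = cong₂ ℤ._+_ (geometric-zero s c F n (≡0 ∘ m<n⇒m<1+n)) (≡0 ≤-refl)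

*-cancelˡ-nonneg : ∀ {d x} → 0 < d → 0ℤ ℤ.≤ + d ℤ.* x → 0ℤ ℤ.≤ x
*-cancelˡ-nonneg {suc d} {x} _ 0≤dx =
  ℤ.*-cancelˡ-≤-pos 0ℤ x (+ suc d) (subst (ℤ._≤ + suc d ℤ.* x) (sym (ℤ.*-zeroʳ (+ suc d))) 0≤dx)

-- Representations by two coprime numbers

q^-multiples : ∀ a v n → (q^ a *ₚ multiples v) n ≡ 0ℤ ⊎
               (q^ a *ₚ multiples v) n ≡ 1ℤ × ∃ λ n′ → n ≡ a + n′ × v ∣ n′
q^-multiples a v n with <-or-+ a n
... | inj₁ n<a = inj₁ (q^-*ₚ-< a (multiples v) n<a)
... | inj₂ (n′ , refl) with v ∣? n′
...   | yes v∣n′ = inj₂ (trans (q^-*ₚ-+ a (multiples v) n′) (multiples-∣ v∣n′) , n′ , refl , v∣n′)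
...   | no  v∤n′ = inj₁ (trans (q^-*ₚ-+ a (multiples v) n′) (multiples-∤ v∤n′))

module Representations (u v : ℕ) (0<u : 0 < u) (0<v : 0 < v) (coprime : Coprime v u) where

  private
    D : ℕ
    D = v * u

  -- `R n` counts the pairs of nonnegative integers `(a, b)` with `a u + b v = n`.
  R : PowerSeries
  R = multiples u *ₚ multiples v

  R-nonneg : Nonnegative R
  R-nonneg = *ₚ-nonneg (multiples-nonneg u) (multiples-nonneg v)

  R-inverse : R *ₚ ((1ₚ -ₚ q^ u) *ₚ (1ₚ -ₚ q^ v)) ≗ 1ₚ
  R-inverse = begin
    (multiples u *ₚ multiples v) *ₚ ((1ₚ -ₚ q^ u) *ₚ (1ₚ -ₚ q^ v))
      ≈⟨ solve 4 (λ a b c d → (a :* b) :* (c :* d) := (a :* c) :* (b :* d)) ≗-refl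
           (multiples u) (multiples v) (1ₚ -ₚ q^ u) (1ₚ -ₚ q^ v) ⟩
    (multiples u *ₚ (1ₚ -ₚ q^ u)) *ₚ (multiples v *ₚ (1ₚ -ₚ q^ v))
      ≈⟨ *ₚ-cong (multiples-inverse 0<u) (multiples-inverse 0<v) ⟩
    1ₚ *ₚ 1ₚ  ≈⟨ *ₚ-identityʳ 1ₚ ⟩
    1ₚ        ∎
    where open ≗-Reasoning

  -- (1 - q^D) R; its n-th coefficient counts the j < v with n - j u a
  -- nonnegative multiple of v.
  residues : ℕ → PowerSeries
  residues c = geometric u c (multiples v)

  -- The factor `1 - q^u` divides `1 - q^D` with a geometric sum of `v` terms as quotient, so only
  -- the series `multiples v` of `R` survives.
  R-step : R *ₚ (1ₚ -ₚ q^ D) ≗ residues v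
  R-step = begin
    (multiples u *ₚ multiples v) *ₚ (1ₚ -ₚ q^ D)
      ≈⟨ solve 3 (λ a b c → (a :* b) :* c := (c :* b) :* a) ≗-refl (multiples u) (multiples v) (1ₚ -ₚ q^ D) ⟩
    ((1ₚ -ₚ q^ D) *ₚ multiples v) *ₚ multiples u
      ≈⟨ *-congʳ (geometric-*ₚ u v (multiples v)) ⟨
    (residues v *ₚ (1ₚ -ₚ q^ u)) *ₚ multiples u
      ≈⟨ solve 3 (λ a b c → (a :* b) :* c := a :* (c :* b)) ≗-refl (residues v) (1ₚ -ₚ q^ u) (multiples u) ⟩
    residues v *ₚ (multiples u *ₚ (1ₚ -ₚ q^ u))
      ≈⟨ *-congˡ {residues v} (multiples-inverse 0<u) ⟩
    residues v *ₚ 1ₚ  ≈⟨ *ₚ-identityʳ (residues v) ⟩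
    residues v        ∎
    where open ≗-Reasoning

  -- If the summands `j < c` were both nonzero at `n`, then `v` would divide `u (c - j)`, hence
  -- `c - j` by coprimality, although `0 < c - j < v`.
  residues-≤1 : ∀ c → c ≤ v → ∀ n → residues c n ℤ.≤ 1ℤ
  residues-≤1 zero    _   n = +≤+ z≤n
  residues-≤1 (suc c) c<v n with q^-multiples (c * u) v n
  ... | inj₁ ≡0 = ℤ.+-mono-≤ (residues-≤1 c (<⇒≤ c<v) n) (ℤ.≤-reflexive ≡0)
  ... | inj₂ (≡1 , n₁ , n≡cu+n₁ , v∣n₁) =
    ℤ.≤-reflexive (cong₂ ℤ._+_ (geometric-zero u c (multiples v) n others-vanish) ≡1)
    where
    others-vanish : ∀ {j} → j < c → (q^ (j * u) *ₚ multiples v) n ≡ 0ℤ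
    others-vanish {j} j<c with q^-multiples (j * u) v n
    ... | inj₁ ≡0 = ≡0
    ... | inj₂ (_ , n₂ , n≡ju+n₂ , v∣n₂) = contradiction
      (coprime-divisor coprime (∣m+n∣m⇒∣n (subst (v ∣_) n₂≡n₁+ud v∣n₂) v∣n₁))
      (>⇒∤ {{>-nonZero (m<n⇒0<n∸m j<c)}} (≤-<-trans (m∸n≤m c j) c<v))
      where
      d = c ∸ j
      distribute : ∀ j d u n₁ → (j + d) * u + n₁ ≡ j * u + (n₁ + u * d)
      distribute = ℕ-Solver.solve-∀
      n₂≡n₁+ud : n₂ ≡ n₁ + u * d
      n₂≡n₁+ud = +-cancelˡ-≡ (j * u) n₂ (n₁ + u * d) (begin
        j * u + n₂                ≡⟨ n≡ju+n₂ ⟨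
        n                         ≡⟨ n≡cu+n₁ ⟩
        c * u + n₁                ≡⟨ cong (λ c → c * u + n₁) (m+[n∸m]≡n (<⇒≤ j<c)) ⟨
        (j + d) * u + n₁          ≡⟨ distribute j d u n₁ ⟩
        j * u + (n₁ + u * d)      ∎)
        where open ≡-Reasoning

  -- Here `w` inverts `u` modulo `v`; the multiple `α * v` on the left stands in for a subtraction.
  inverse-mod : ∃ λ w → ∃ λ α → ∃ λ β → w * u + α * v ≡ 1 + β * v
  inverse-mod with coprime-Bézout coprime
  -- Now `y u` is `-1` modulo `v`, so `y (u y)` is the inverse: `(y u)² = (x v - 1)²`.
  ... | Bézout.+- x y 1+yu≡xv = y * (u * y) , 2 * x , x * x * v , lemma
    where
    lemma : y * (u * y) * u + 2 * x * v ≡ 1 + x * x * v * v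
    lemma = begin
      y * (u * y) * u + 2 * x * v  ≡⟨ square x y u v ⟩
      (y * u) * (y * u) + 2 * (x * v)            ≡⟨ cong (λ z → (y * u) * (y * u) + 2 * z) 1+yu≡xv ⟨
      (y * u) * (y * u) + 2 * (1 + y * u)        ≡⟨ complete (y * u) ⟩
      1 + (1 + y * u) * (1 + y * u)              ≡⟨ cong (λ z → 1 + z * z) 1+yu≡xv ⟩
      1 + (x * v) * (x * v)                      ≡⟨ assoc x v ⟩
      1 + x * x * v * v                          ∎
      where
      open ≡-Reasoning
      square : ∀ x y u v → y * (u * y) * u + 2 * x * v ≡ (y * u) * (y * u) + 2 * (x * v)
      square = ℕ-Solver.solve-∀
      complete : ∀ z → z * z + 2 * (1 + z) ≡ 1 + (1 + z) * (1 + z)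
      complete = ℕ-Solver.solve-∀
      assoc : ∀ x v → 1 + (x * v) * (x * v) ≡ 1 + x * x * v * v
      assoc = ℕ-Solver.solve-∀
  ... | Bézout.-+ x y 1+xv≡yu = y , 0 , x , trans (+-identityʳ (y * u)) (sym 1+xv≡yu)

  -- The summand `j = n w mod v` is nonzero: `v` divides `n - j u`, and `D ≤ n` ensures `j u ≤ n`.
  residues-≥1 : ∀ {n} → D ≤ n → 1ℤ ℤ.≤ residues v n
  residues-≥1 {n} D≤n with inverse-mod
  ... | w , α , β , wu+αv≡1+βv = ℤ.≤-trans (ℤ.≤-reflexive (sym summand≡1))
    (geometric-≥-summand u v (multiples-nonneg v) j<v n)
    where
    instance
      v-nonZero : NonZero v
      v-nonZero = >-nonZero 0<v
    j n′ q : ℕ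
    j = (n * w) % v
    q = (n * w) /ℕ v
    n′ = n ∸ j * u
    j<v : j < v
    j<v = m%n<n (n * w) v
    ju+n′≡n : j * u + n′ ≡ n
    ju+n′≡n = m+[n∸m]≡n (≤-trans (*-monoˡ-≤ u (<⇒≤ j<v)) D≤n)
    -- The extra term `n * β * v` avoids subtraction and, being a multiple of `v`, can be discarded
    -- afterwards.
    n′-multiple : n * β * v + n′ ≡ (q * u + n * α) * v
    n′-multiple = +-cancelˡ-≡ (j * u) (n * β * v + n′) ((q * u + n * α) * v) (begin
      j * u + (n * β * v + n′)         ≡⟨ regroup₁ (j * u) (n * β * v) n′ ⟩
      (j * u + n′) + n * β * v         ≡⟨ cong (_+ n * β * v) ju+n′≡n ⟩
      n + n * β * v                    ≡⟨ regroup₂ n β v ⟩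
      n * (1 + β * v)                  ≡⟨ cong (n *_) wu+αv≡1+βv ⟨
      n * (w * u + α * v)              ≡⟨ regroup₃ n w u α v ⟩
      (n * w) * u + n * α * v          ≡⟨ cong (λ z → z * u + n * α * v) (m≡m%n+[m/n]*n (n * w) v) ⟩
      (j + q * v) * u + n * α * v      ≡⟨ regroup₄ j q v u (n * α) ⟩
      j * u + (q * u + n * α) * v      ∎)
      where
      open ≡-Reasoning
      regroup₁ : ∀ a b c → a + (b + c) ≡ (a + c) + b
      regroup₁ = ℕ-Solver.solve-∀
      regroup₂ : ∀ n β v → n + n * β * v ≡ n * (1 + β * v)
      regroup₂ = ℕ-Solver.solve-∀
      regroup₃ : ∀ n w u α v → n * (w * u + α * v) ≡ (n * w) * u + n * α * v
      regroup₃ = ℕ-Solver.solve-∀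
      regroup₄ : ∀ j q v u a → (j + q * v) * u + a * v ≡ j * u + (q * u + a) * v
      regroup₄ = ℕ-Solver.solve-∀
    summand≡1 : (q^ (j * u) *ₚ multiples v) n ≡ 1ℤ
    summand≡1 = begin
      (q^ (j * u) *ₚ multiples v) n             ≡⟨ cong (q^ (j * u) *ₚ multiples v) ju+n′≡n ⟨
      (q^ (j * u) *ₚ multiples v) (j * u + n′)  ≡⟨ q^-*ₚ-+ (j * u) (multiples v) n′ ⟩
      multiples v n′
        ≡⟨ multiples-∣ (∣m+n∣m⇒∣n (divides (q * u + n * α) n′-multiple) (n∣m*n (n * β))) ⟩
      1ℤ                                        ∎
      where open ≡-Reasoning

  R-recurrence : ∀ n → R n ≡ residues v n ℤ.+ (q^ D *ₚ R) n
  R-recurrence n = begin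
    R n                                                ≡⟨ lemma (R n) ((q^ D *ₚ R) n) ⟩
    (R n ℤ.- (q^ D *ₚ R) n) ℤ.+ (q^ D *ₚ R) n          ≡⟨ cong (ℤ._+ (q^ D *ₚ R) n) (expand n) ⟨
    (R *ₚ (1ₚ -ₚ q^ D)) n ℤ.+ (q^ D *ₚ R) n            ≡⟨ cong (ℤ._+ (q^ D *ₚ R) n) (R-step n) ⟩
    residues v n ℤ.+ (q^ D *ₚ R) n                     ∎
    where
    open ≡-Reasoning
    lemma : ∀ a b → a ≡ (a ℤ.- b) ℤ.+ b
    lemma = ℤ-Solver.solve-∀
    expand : R *ₚ (1ₚ -ₚ q^ D) ≗ R -ₚ q^ D *ₚ R
    expand = solve 2 (λ r x → r :* (con 1ℤ :- x) := r :- x :* r) ≗-refl R (q^ D)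

  R-+ : ∀ n → R (D + n) ≡ 1ℤ ℤ.+ R n
  R-+ n = begin
    R (D + n)                                    ≡⟨ R-recurrence (D + n) ⟩
    residues v (D + n) ℤ.+ (q^ D *ₚ R) (D + n)   ≡⟨ cong₂ ℤ._+_ residues≡1 (q^-*ₚ-+ D R n) ⟩
    1ℤ ℤ.+ R n                                   ∎
    where
    open ≡-Reasoning
    residues≡1 = ℤ.≤-antisym (residues-≤1 v ≤-refl (D + n)) (residues-≥1 (m≤m+n D n))

  -- Below `D` the coefficient `R n` is 0 or 1. By `R-+`, a shift by `D` raises both `n` and
  -- `D R(n)` by `D`, so the error never grows.
  R-bounds : ∀ n → (+ n ℤ.≤ + D ℤ.* R n ℤ.+ + D) × (+ D ℤ.* R n ℤ.≤ + n ℤ.+ + D)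
  R-bounds = <-rec (λ n → (+ n ℤ.≤ + D ℤ.* R n ℤ.+ + D) × (+ D ℤ.* R n ℤ.≤ + n ℤ.+ + D)) bounds
    where
    open ℤ.≤-Reasoning
    bounds : ∀ n → (∀ {m} → m < n → (+ m ℤ.≤ + D ℤ.* R m ℤ.+ + D) × (+ D ℤ.* R m ℤ.≤ + m ℤ.+ + D)) →
             (+ n ℤ.≤ + D ℤ.* R n ℤ.+ + D) × (+ D ℤ.* R n ℤ.≤ + n ℤ.+ + D)
    bounds n rec with <-or-+ D n
    ... | inj₁ n<D = lower , upper
      where
      lower = begin
        + n                     ≤⟨ +≤+ (<⇒≤ n<D) ⟩
        + D                     ≡⟨ ℤ.+-identityˡ (+ D) ⟨
        0ℤ ℤ.+ + D              ≤⟨ ℤ.+-monoˡ-≤ (+ D) (*-nonneg {+ D} (+≤+ z≤n) (R-nonneg n)) ⟩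
        + D ℤ.* R n ℤ.+ + D     ∎
      upper = begin
        + D ℤ.* R n                             ≡⟨ cong (+ D ℤ.*_) (R-recurrence n) ⟩
        + D ℤ.* (residues v n ℤ.+ (q^ D *ₚ R) n) ≡⟨ cong (λ x → + D ℤ.* (residues v n ℤ.+ x)) (q^-*ₚ-< D R n<D) ⟩
        + D ℤ.* (residues v n ℤ.+ 0ℤ)           ≡⟨ cong (+ D ℤ.*_) (ℤ.+-identityʳ (residues v n)) ⟩
        + D ℤ.* residues v n                    ≤⟨ ℤ.*-monoˡ-≤-nonNeg (+ D) (residues-≤1 v ≤-refl n) ⟩
        + D ℤ.* 1ℤ                              ≡⟨ ℤ.*-identityʳ (+ D) ⟩
        + D                                     ≤⟨ +≤+ (m≤n+m D n) ⟩
        + n ℤ.+ + D                             ∎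
    ... | inj₂ (m , refl) with rec (m<n+m m (*-mono-< 0<v 0<u))
    ...   | m≤ , ≤m = lower , upper
      where
      D+R : + D ℤ.* R (D + m) ≡ + D ℤ.+ + D ℤ.* R m
      D+R = trans (cong (+ D ℤ.*_) (R-+ m)) (lemma (+ D) (R m))
        where
        lemma : ∀ a b → a ℤ.* (1ℤ ℤ.+ b) ≡ a ℤ.+ a ℤ.* b
        lemma = ℤ-Solver.solve-∀
      lower = begin
        + D ℤ.+ + m                            ≤⟨ ℤ.+-monoʳ-≤ (+ D) m≤ ⟩
        + D ℤ.+ (+ D ℤ.* R m ℤ.+ + D)          ≡⟨ ℤ.+-assoc (+ D) (+ D ℤ.* R m) (+ D) ⟨
        (+ D ℤ.+ + D ℤ.* R m) ℤ.+ + D          ≡⟨ cong (ℤ._+ + D) D+R ⟨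
        + D ℤ.* R (D + m) ℤ.+ + D              ∎
      upper = begin
        + D ℤ.* R (D + m)                      ≡⟨ D+R ⟩
        + D ℤ.+ + D ℤ.* R m                    ≤⟨ ℤ.+-monoʳ-≤ (+ D) ≤m ⟩
        + D ℤ.+ (+ m ℤ.+ + D)                  ≡⟨ ℤ.+-assoc (+ D) (+ m) (+ D) ⟨
        + (D + m) ℤ.+ + D                      ∎

  R-upper : ∀ a n → + D ℤ.* (q^ a *ₚ R) n ℤ.≤ + (n + D)
  R-upper a n with <-or-+ a n
  ... | inj₁ n<a = begin
    + D ℤ.* (q^ a *ₚ R) n  ≡⟨ cong (+ D ℤ.*_) (q^-*ₚ-< a R n<a) ⟩
    + D ℤ.* 0ℤ             ≡⟨ ℤ.*-zeroʳ (+ D) ⟩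
    0ℤ                     ≤⟨ +≤+ z≤n ⟩
    + (n + D)              ∎
    where open ℤ.≤-Reasoning
  ... | inj₂ (m , refl) = begin
    + D ℤ.* (q^ a *ₚ R) (a + m)  ≡⟨ cong (+ D ℤ.*_) (q^-*ₚ-+ a R m) ⟩
    + D ℤ.* R m                  ≤⟨ proj₂ (R-bounds m) ⟩
    + (m + D)                    ≤⟨ +≤+ (+-monoˡ-≤ D (m≤n+m m a)) ⟩
    + (a + m + D)                ∎
    where open ℤ.≤-Reasoning

  -- The quotient of one pair of numerator terms

  module Increments (κ : ℕ) where

    private
      y : ℕ
      y = κ + 2 * D

    K : PowerSeries
    K = R -ₚ q^ y *ₚ R

    -- Each of the two values of `R` may be off by `D` after scaling, so of the distance `y` the
    -- part `κ = y - 2D` remains.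
    K-lower : ∀ {n} → y ≤ n → + κ ℤ.≤ + D ℤ.* K n
    K-lower {n} y≤n = subst (λ n → + κ ℤ.≤ + D ℤ.* K n) (m+[n∸m]≡n y≤n) (begin
      + κ
        ≡⟨ lemma₁ (+ κ) (+ D) (+ m) ⟩
      (+ κ ℤ.+ + 2 ℤ.* + D ℤ.+ + m) ℤ.- (+ m ℤ.+ + D) ℤ.- + D
        ≡⟨ cong (λ z → (+ κ ℤ.+ z ℤ.+ + m) ℤ.- (+ m ℤ.+ + D) ℤ.- + D) (ℤ.pos-* 2 D) ⟨
      + (y + m) ℤ.- (+ m ℤ.+ + D) ℤ.- + D
        ≤⟨ ℤ.+-monoˡ-≤ (ℤ.- + D) (ℤ.+-mono-≤ (proj₁ (R-bounds (y + m))) (ℤ.neg-mono-≤ (proj₂ (R-bounds m)))) ⟩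
      + D ℤ.* R (y + m) ℤ.+ + D ℤ.- + D ℤ.* R m ℤ.- + D
        ≡⟨ lemma₂ (+ D) (R (y + m)) (R m) ⟩
      + D ℤ.* (R (y + m) ℤ.- R m)
        ≡⟨ cong (λ z → + D ℤ.* (R (y + m) ℤ.- z)) (q^-*ₚ-+ y R m) ⟨
      + D ℤ.* K (y + m) ∎)
      where
      open ℤ.≤-Reasoning
      m = n ∸ y
      lemma₁ : ∀ κ D m → κ ≡ (κ ℤ.+ + 2 ℤ.* D ℤ.+ m) ℤ.- (m ℤ.+ D) ℤ.- D
      lemma₁ = ℤ-Solver.solve-∀
      lemma₂ : ∀ D a b → D ℤ.* a ℤ.+ D ℤ.- D ℤ.* b ℤ.- D ≡ D ℤ.* (a ℤ.- b)
      lemma₂ = ℤ-Solver.solve-∀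

    K-nonneg : Nonnegative K
    K-nonneg n with <-≤-connex n y
    ... | inj₁ n<y = subst (0ℤ ℤ.≤_)
      (sym (trans (cong (λ z → R n ℤ.- z) (q^-*ₚ-< y R n<y)) (ℤ.+-identityʳ (R n)))) (R-nonneg n)
    ... | inj₂ y≤n = *-cancelˡ-nonneg (*-mono-< 0<v 0<u) (ℤ.≤-trans (+≤+ z≤n) (K-lower y≤n))

    -- At such a degree all `c` shifted copies of `K` are read at or beyond `y`, and each
    -- contributes `κ`.
    geometric-K-lower : ∀ s c {n} → y + c * s ≤ n → + (c * κ) ℤ.≤ + D ℤ.* geometric s c K n
    geometric-K-lower s zero    {n} _ = ℤ.≤-reflexive (sym (ℤ.*-zeroʳ (+ D)))
    geometric-K-lower s (suc c) {n} y+[1+c]s≤n = begin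
      + κ ℤ.+ + (c * κ)
        ≤⟨ ℤ.+-mono-≤ (K-lower y≤m) (geometric-K-lower s c (≤-trans (+-monoʳ-≤ y (m≤n+m (c * s) s)) y+[1+c]s≤n)) ⟩
      + D ℤ.* K m ℤ.+ + D ℤ.* geometric s c K n
        ≡⟨ cong (λ z → + D ℤ.* z ℤ.+ + D ℤ.* geometric s c K n) shifted ⟨
      + D ℤ.* (q^ (c * s) *ₚ K) n ℤ.+ + D ℤ.* geometric s c K n
        ≡⟨ lemma (+ D) ((q^ (c * s) *ₚ K) n) (geometric s c K n) ⟩
      + D ℤ.* geometric s (suc c) K n ∎
      where
      open ℤ.≤-Reasoning
      m = n ∸ c * s
      lemma : ∀ d a b → d ℤ.* a ℤ.+ d ℤ.* b ≡ d ℤ.* (b ℤ.+ a)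
      lemma = ℤ-Solver.solve-∀
      y+cs≤n : y + c * s ≤ n
      y+cs≤n = ≤-trans (+-monoʳ-≤ y (m≤n+m (c * s) s)) y+[1+c]s≤n
      y≤m : y ≤ m
      y≤m = m+n≤o⇒m≤o∸n y y+cs≤n
      shifted : (q^ (c * s) *ₚ K) n ≡ K m
      shifted = trans (cong (q^ (c * s) *ₚ K) (sym (m+[n∸m]≡n (m+n≤o⇒n≤o y y+cs≤n)))) (q^-*ₚ-+ (c * s) K m)

    -- With x = c s, the two summands are the quotients of (1 - q^x)(1 - q^y)
    -- and q^(x+y) (1 - q^(2s)) by (1 - q^s)(1 - q^u)(1 - q^v).
    pairQuotient : (s c : ℕ) → PowerSeries
    pairQuotient s c = geometric s c K -ₚ q^ (c * s + y) *ₚ (R +ₚ q^ s *ₚ R)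

    -- With `x`, `y`, `t` for the powers of q, the identity is `(1 - x)(1 - y) - x y (1 - t²) = (1 -
    -- x) - y (1 - x t²)`; the factor `1 - t²` arises from `R + t R` and `1 - t`.
    pairQuotient-*ₚ : ∀ s c →
      pairQuotient s c *ₚ ((1ₚ -ₚ q^ s) *ₚ (1ₚ -ₚ q^ u) *ₚ (1ₚ -ₚ q^ v)) ≗
      (1ₚ -ₚ q^ (c * s)) -ₚ q^ y *ₚ (1ₚ -ₚ q^ (c * s + 2 * s))
    pairQuotient-*ₚ s c = begin
      (G -ₚ q^ (c * s + y) *ₚ (R +ₚ t *ₚ R)) *ₚ ((1ₚ -ₚ t) *ₚ U *ₚ V)
        ≈⟨ solve 6 (λ g z r t u v →
             (g :- z :* (r :+ t :* r)) :* ((con 1ℤ :- t) :* u :* v) :=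
             (g :* (con 1ℤ :- t)) :* (u :* v) :- z :* (con 1ℤ :- t :* t) :* (r :* (u :* v)))
             ≗-refl G (q^ (c * s + y)) R t U V ⟩
      (G *ₚ (1ₚ -ₚ t)) *ₚ (U *ₚ V) -ₚ q^ (c * s + y) *ₚ (1ₚ -ₚ t *ₚ t) *ₚ (R *ₚ (U *ₚ V))
        ≈⟨ (λ n → cong₂ ℤ._-_ (*-congʳ {U *ₚ V} (geometric-*ₚ s c K) n)
             (*ₚ-cong (*-congʳ {1ₚ -ₚ t *ₚ t} (q^-+ (c * s) y)) R-inverse n)) ⟩
      (1ₚ -ₚ X) *ₚ (R -ₚ Y *ₚ R) *ₚ (U *ₚ V) -ₚ (X *ₚ Y) *ₚ (1ₚ -ₚ t *ₚ t) *ₚ 1ₚ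
        ≈⟨ solve 5 (λ x y r w t →
             (con 1ℤ :- x) :* (r :- y :* r) :* w :- (x :* y) :* (con 1ℤ :- t :* t) :* con 1ℤ :=
             (con 1ℤ :- x) :* (con 1ℤ :- y) :* (r :* w) :- (x :* y) :* (con 1ℤ :- t :* t))
             ≗-refl X Y R (U *ₚ V) t ⟩
      (1ₚ -ₚ X) *ₚ (1ₚ -ₚ Y) *ₚ (R *ₚ (U *ₚ V)) -ₚ (X *ₚ Y) *ₚ (1ₚ -ₚ t *ₚ t)
        ≈⟨ +-congʳ (*-congˡ {(1ₚ -ₚ X) *ₚ (1ₚ -ₚ Y)} R-inverse) ⟩
      (1ₚ -ₚ X) *ₚ (1ₚ -ₚ Y) *ₚ 1ₚ -ₚ (X *ₚ Y) *ₚ (1ₚ -ₚ t *ₚ t)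
        ≈⟨ solve 3 (λ x y t →
             (con 1ℤ :- x) :* (con 1ℤ :- y) :* con 1ℤ :- (x :* y) :* (con 1ℤ :- t :* t) :=
             (con 1ℤ :- x) :- y :* (con 1ℤ :- x :* (t :* (t :* con 1ℤ))))
             ≗-refl X Y t ⟩
      (1ₚ -ₚ X) -ₚ Y *ₚ (1ₚ -ₚ X *ₚ (t *ₚ (t *ₚ 1ₚ)))
        ≈⟨ (λ n → cong (λ z → (1ₚ -ₚ X) n ℤ.- z) (*-congˡ {Y} (λ m → cong (λ z → 1ₚ m ℤ.- z) (exponents m)) n)) ⟨
      (1ₚ -ₚ X) -ₚ Y *ₚ (1ₚ -ₚ q^ (c * s + 2 * s)) ∎
      where
      open ≗-Reasoning
      G t U V X Y : PowerSeries
      G = geometric s c K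
      t = q^ s
      U = 1ₚ -ₚ q^ u
      V = 1ₚ -ₚ q^ v
      X = q^ (c * s)
      Y = q^ y
      -- `2 * s` unfolds to `s + (s + 0)`, whence the trailing `1ₚ`.
      exponents : q^ (c * s + 2 * s) ≗ X *ₚ (t *ₚ (t *ₚ 1ₚ))
      exponents = ≗-trans (q^-+ (c * s) (2 * s)) (*-congˡ {X} (≗-trans (q^-+ s (s + 0)) (*-congˡ {t} (q^-+ s 0))))

    pairQuotient-nonneg : ∀ s c {n} → n < c * s + y → 0ℤ ℤ.≤ pairQuotient s c n
    pairQuotient-nonneg s c {n} n<cs+y = subst (0ℤ ℤ.≤_)
      (sym (trans (cong (λ z → geometric s c K n ℤ.- z) (q^-*ₚ-< (c * s + y) (R +ₚ q^ s *ₚ R) n<cs+y))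
        (ℤ.+-identityʳ (geometric s c K n))))
      (geometric-nonneg s c K-nonneg n)

    -- The gain is `geometric-K-lower`; the loss consists of two shifted copies of `R`, each at most
    -- `n + D` after scaling by `D`.
    pairQuotient-lower : ∀ s c {n} → c * s + y ≤ n →
                         + (c * κ) ℤ.≤ + D ℤ.* pairQuotient s c n ℤ.+ + (2 * (n + D))
    pairQuotient-lower s c {n} cs+y≤n = begin
      + (c * κ)
        ≤⟨ geometric-K-lower s c (subst (_≤ n) (+-comm (c * s) y) cs+y≤n) ⟩
      + D ℤ.* g
        ≡⟨ lemma₁ (+ D) g (R m) ((q^ s *ₚ R) m) ⟩
      + D ℤ.* (g ℤ.- (R m ℤ.+ (q^ s *ₚ R) m)) ℤ.+ (+ D ℤ.* R m ℤ.+ + D ℤ.* (q^ s *ₚ R) m)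
        ≤⟨ ℤ.+-monoʳ-≤ (+ D ℤ.* (g ℤ.- (R m ℤ.+ (q^ s *ₚ R) m))) (ℤ.+-mono-≤ (proj₂ (R-bounds m)) (R-upper s m)) ⟩
      + D ℤ.* (g ℤ.- (R m ℤ.+ (q^ s *ₚ R) m)) ℤ.+ + ((m + D) + (m + D))
        ≤⟨ ℤ.+-monoʳ-≤ (+ D ℤ.* (g ℤ.- (R m ℤ.+ (q^ s *ₚ R) m))) (+≤+ (double-mono m+D≤n+D)) ⟩
      + D ℤ.* (g ℤ.- (R m ℤ.+ (q^ s *ₚ R) m)) ℤ.+ + (2 * (n + D))
        ≡⟨ cong (λ z → + D ℤ.* (g ℤ.- z) ℤ.+ + (2 * (n + D))) shifted ⟨
      + D ℤ.* pairQuotient s c n ℤ.+ + (2 * (n + D)) ∎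
      where
      open ℤ.≤-Reasoning
      m = n ∸ (c * s + y)
      g = geometric s c K n
      m+D≤n+D : m + D ≤ n + D
      m+D≤n+D = +-monoˡ-≤ D (m∸n≤m n (c * s + y))
      double-mono : ∀ {a b} → a ≤ b → a + a ≤ 2 * b
      double-mono {a} {b} a≤b = +-mono-≤ a≤b (≤-trans a≤b (m≤m+n b 0))
      lemma₁ : ∀ d g a b → d ℤ.* g ≡ d ℤ.* (g ℤ.- (a ℤ.+ b)) ℤ.+ (d ℤ.* a ℤ.+ d ℤ.* b)
      lemma₁ = ℤ-Solver.solve-∀
      shifted : (q^ (c * s + y) *ₚ (R +ₚ q^ s *ₚ R)) n ≡ R m ℤ.+ (q^ s *ₚ R) m
      shifted = trans (cong (q^ (c * s + y) *ₚ (R +ₚ q^ s *ₚ R)) (sym (m+[n∸m]≡n cs+y≤n)))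
        (q^-*ₚ-+ (c * s + y) (R +ₚ q^ s *ₚ R) m)

-- Summation over the pairs

shiftedSum : (ℕ → ℕ) → (ℕ → PowerSeries) → ℕ → PowerSeries
shiftedSum E Q zero    = 0ₚ
shiftedSum E Q (suc N) = shiftedSum E Q N +ₚ q^ (E N) *ₚ Q N

-- Each Q i may decrease at slope 2 / D from some point on, but what it has
-- gained by the time the shift reaches E (i + 2) makes up for the decrease
-- of its predecessors.
module ShiftedSum
  (D : ℕ) (0<D : 0 < D) (E g t W : ℕ → ℕ) (Q : ℕ → PowerSeries)
  (E-suc : ∀ i → E (suc i) ≡ E i + g i) (t≤g : ∀ i → t i ≤ g i)
  (Q-nonneg : ∀ i {n} → n < t i → 0ℤ ℤ.≤ Q i n)
  (Q-lower : ∀ i {n} → t i ≤ n → + W i ℤ.≤ + D ℤ.* Q i n ℤ.+ + (2 * n))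
  (W-lower : ∀ i → 2 * i * g (suc i) + 2 * (g i + g (suc i)) ≤ W i)
  where

  -- Past `t i` the loss `2 n` is still below `2 g i`, which `W i` covers.
  Q-nonneg-gap : ∀ i {n} → n < g i → 0ℤ ℤ.≤ Q i n
  Q-nonneg-gap i {n} n<g with <-≤-connex n (t i)
  ... | inj₁ n<t = Q-nonneg i n<t
  ... | inj₂ t≤n = *-cancelˡ-nonneg 0<D (begin
    0ℤ                                          ≡⟨ ℤ.+-inverseʳ (+ (2 * n)) ⟨
    + (2 * n) ℤ.- + (2 * n)                     ≤⟨ ℤ.+-monoˡ-≤ (ℤ.- + (2 * n)) (+≤+ 2n≤W) ⟩
    + W i ℤ.- + (2 * n)                         ≤⟨ ℤ.+-monoˡ-≤ (ℤ.- + (2 * n)) (Q-lower i t≤n) ⟩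
    + D ℤ.* Q i n ℤ.+ + (2 * n) ℤ.- + (2 * n)   ≡⟨ lemma (+ D ℤ.* Q i n) (+ (2 * n)) ⟩
    + D ℤ.* Q i n                               ∎)
    where
    open ℤ.≤-Reasoning
    lemma : ∀ a b → a ℤ.+ b ℤ.- b ≡ a
    lemma = ℤ-Solver.solve-∀
    2n≤W : 2 * n ≤ W i
    2n≤W = ≤-trans (*-monoʳ-≤ 2 (≤-trans (<⇒≤ n<g) (m≤m+n (g i) (g (suc i)))))
      (≤-trans (m≤n+m (2 * (g i + g (suc i))) (2 * i * g (suc i))) (W-lower i))

  -- The invariant says that `N` pairs, losing together at slope `2N / D`, have gained enough to
  -- last until `E (suc N)`. When `E (suc (suc N))` is expanded by `E-suc`, the induction step
  -- becomes precisely `W-lower N`.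
  shiftedSum-lower : ∀ N {n} → E N ≤ n →
    + (2 * N * E (suc N)) ℤ.≤ + D ℤ.* shiftedSum E Q N n ℤ.+ + (2 * N * n)
  shiftedSum-lower zero    {n} _ = ℤ.≤-reflexive (sym (trans (ℤ.+-identityʳ (+ D ℤ.* 0ℤ)) (ℤ.*-zeroʳ (+ D))))
  shiftedSum-lower (suc N) {n} E≤n = begin
    + (2 * suc N * E (suc (suc N)))
      ≤⟨ +≤+ growth ⟩
    -- `Q N` is read at `m = n - E N`; the summand `2 * E N` turns its loss `2 * m` into `2 * n`.
    + (2 * N * E (suc N) + W N + 2 * E N)
      ≤⟨ ℤ.+-monoˡ-≤ (+ (2 * E N)) (ℤ.+-mono-≤ (shiftedSum-lower N E≤n′) (Q-lower N t≤m)) ⟩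
    (+ D ℤ.* S ℤ.+ + (2 * N * n)) ℤ.+ (+ D ℤ.* Q N m ℤ.+ + (2 * m)) ℤ.+ + (2 * E N)
      ≡⟨ lemma (+ D) S (Q N m) (+ (2 * N * n)) (+ (2 * m)) (+ (2 * E N)) ⟩
    + D ℤ.* (S ℤ.+ Q N m) ℤ.+ + (2 * N * n + 2 * m + 2 * E N)
      ≡⟨ cong₂ (λ z n′ → + D ℤ.* (S ℤ.+ z) ℤ.+ + n′) (sym shifted) degrees ⟩
    + D ℤ.* shiftedSum E Q (suc N) n ℤ.+ + (2 * suc N * n) ∎
    where
    open ℤ.≤-Reasoning
    S : ℤ
    S = shiftedSum E Q N n
    m : ℕ
    m = n ∸ E N
    E+g≤n : E N + g N ≤ n
    E+g≤n = subst (_≤ n) (E-suc N) E≤n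
    E≤n′ : E N ≤ n
    E≤n′ = m+n≤o⇒m≤o (E N) E+g≤n
    E+m≡n : E N + m ≡ n
    E+m≡n = m+[n∸m]≡n E≤n′
    t≤m : t N ≤ m
    t≤m = ≤-trans (t≤g N) (m+n≤o⇒m≤o∸n (g N) (subst (_≤ n) (+-comm (E N) (g N)) E+g≤n))
    shifted : (q^ (E N) *ₚ Q N) n ≡ Q N m
    shifted = trans (cong (q^ (E N) *ₚ Q N) (sym E+m≡n)) (q^-*ₚ-+ (E N) (Q N) m)
    lemma : ∀ d s q a b c → (d ℤ.* s ℤ.+ a) ℤ.+ (d ℤ.* q ℤ.+ b) ℤ.+ c ≡ d ℤ.* (s ℤ.+ q) ℤ.+ (a ℤ.+ b ℤ.+ c)
    lemma = ℤ-Solver.solve-∀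
    degrees : 2 * N * n + 2 * m + 2 * E N ≡ 2 * suc N * n
    degrees = trans (regroup (2 * N * n) m (E N)) (trans (cong (λ n′ → 2 * N * n + 2 * n′) E+m≡n) (distribute N n))
      where
      regroup : ∀ a m e → a + 2 * m + 2 * e ≡ a + 2 * (e + m)
      regroup = ℕ-Solver.solve-∀
      distribute : ∀ N n → 2 * N * n + 2 * n ≡ 2 * suc N * n
      distribute = ℕ-Solver.solve-∀
    growth : 2 * suc N * E (suc (suc N)) ≤ 2 * N * E (suc N) + W N + 2 * E N
    growth = ≤-trans (≤-reflexive (trans
        (cong (2 * suc N *_) (trans (E-suc (suc N)) (cong (_+ g (suc N)) (E-suc N))))
        (trans (regroup N (E N) (g N) (g (suc N)))
          (cong (λ e → 2 * N * e + (2 * N * g (suc N) + 2 * (g N + g (suc N))) + 2 * E N) (sym (E-suc N))))))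
      (+-monoˡ-≤ (2 * E N) (+-monoʳ-≤ (2 * N * E (suc N)) (W-lower N)))
      where
      regroup : ∀ N e g g′ → 2 * suc N * (e + g + g′) ≡
                2 * N * (e + g) + (2 * N * g′ + 2 * (g + g′)) + 2 * e
      regroup = ℕ-Solver.solve-∀

  -- For `suc N` pairs: below `E (suc N)` the last pair is still inside its gap and the others are
  -- handled by induction; from there up to `E (suc (suc N))` the invariant applies.
  shiftedSum-nonneg : ∀ N {n} → n ≤ E (suc N) → 0ℤ ℤ.≤ shiftedSum E Q N n
  shiftedSum-nonneg zero    _ = ℤ.≤-refl
  shiftedSum-nonneg (suc N) {n} n≤E with <-≤-connex n (E (suc N))
  ... | inj₂ E≤n = *-cancelˡ-nonneg 0<D (begin
    0ℤ                                          ≡⟨ ℤ.+-inverseʳ (+ (2 * suc N * n)) ⟨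
    + (2 * suc N * n) ℤ.- + (2 * suc N * n)
      ≤⟨ ℤ.+-monoˡ-≤ (ℤ.- + (2 * suc N * n)) (+≤+ (*-monoʳ-≤ (2 * suc N) n≤E)) ⟩
    + (2 * suc N * E (suc (suc N))) ℤ.- + (2 * suc N * n)
      ≤⟨ ℤ.+-monoˡ-≤ (ℤ.- + (2 * suc N * n)) (shiftedSum-lower (suc N) E≤n) ⟩
    + D ℤ.* shiftedSum E Q (suc N) n ℤ.+ + (2 * suc N * n) ℤ.- + (2 * suc N * n)
      ≡⟨ lemma (+ D ℤ.* shiftedSum E Q (suc N) n) (+ (2 * suc N * n)) ⟩
    + D ℤ.* shiftedSum E Q (suc N) n ∎)
    where
    open ℤ.≤-Reasoning
    lemma : ∀ a b → a ℤ.+ b ℤ.- b ≡ a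
    lemma = ℤ-Solver.solve-∀
  ... | inj₁ n<E = ℤ.+-mono-≤ (shiftedSum-nonneg N (<⇒≤ n<E)) pair-nonneg
    where
    pair-nonneg : 0ℤ ℤ.≤ (q^ (E N) *ₚ Q N) n
    pair-nonneg with <-or-+ (E N) n
    ... | inj₁ n<EN       = ℤ.≤-reflexive (sym (q^-*ₚ-< (E N) (Q N) n<EN))
    ... | inj₂ (m , refl) = subst (0ℤ ℤ.≤_) (sym (q^-*ₚ-+ (E N) (Q N) m))
      (Q-nonneg-gap N (+-cancelˡ-< (E N) m (g N) (subst (E N + m <_) (E-suc N) n<E)))

-- The numerator

sum-snoc : ∀ (f : ℕ → ℤ) m → ∑[ j < suc m ] f (toℕ j) ≡ (∑[ j < m ] f (toℕ j)) ℤ.+ f m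
sum-snoc f zero    = ℤ.+-comm (f 0) 0ℤ
sum-snoc f (suc m) = trans (cong (λ x → f 0 ℤ.+ x) (sum-snoc (f ∘ suc) m))
  (sym (ℤ.+-assoc (f 0) (∑[ j < m ] f (suc (toℕ j))) (f (suc m))))

-1^-even : ∀ i → -1ℤ ^ℤ (i * 2) ≡ 1ℤ
-1^-even zero    = refl
-1^-even (suc i) = cong (λ x → -1ℤ ℤ.* (-1ℤ ℤ.* x)) (-1^-even i)

exponentStep : (r s k j : ℕ) → ℕ
exponentStep r s k j = r * suc (k + j) ∸ s

-- Adding `s * suc j` and doubling removes the truncated subtraction and the halving, which leaves a
-- polynomial identity.
exponent-suc : ∀ r s k j → 2 * s < r → exponent r s k (suc j) ≡ exponent r s k j + exponentStep r s k j
exponent-suc r s k j 2s<r = +-cancelʳ-≡ (s * suc j) (e (suc j)) (e j + y)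
  (*-cancelˡ-≡ (e (suc j) + s * suc j) (e j + y + s * suc j) 2 (begin
  2 * (e (suc j) + s * suc j)                               ≡⟨ exponent-exact r s k (suc j) 2s<r ⟩
  r * (suc j ^ 2 + (2 * k + 1) * suc j)       ≡⟨ expand r k j ⟩
  r * (j ^ 2 + (2 * k + 1) * j) + 2 * (r * suc (k + j))
    ≡⟨ cong₂ (λ a b → a + 2 * b) (exponent-exact r s k j 2s<r) (m∸n+n≡m s≤r[1+k+j]) ⟨
  2 * (e j + s * j) + 2 * (y + s)                           ≡⟨ regroup (e j) s j y ⟩
  2 * (e j + y + s * suc j)                                 ∎))
  where
  open ≡-Reasoning
  e = exponent r s k
  y = exponentStep r s k j
  s≤r[1+k+j] : s ≤ r * suc (k + j)
  s≤r[1+k+j] = ≤-trans (≤-trans (m≤m+n s (s + 0)) (<⇒≤ 2s<r)) (m≤m*n r (suc (k + j)))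
  expand : ∀ r k j → r * (suc j * (suc j * 1) + (2 * k + 1) * suc j) ≡
                     r * (j * (j * 1) + (2 * k + 1) * j) + 2 * (r * suc (k + j))
  expand = ℕ-Solver.solve-∀
  regroup : ∀ e s j y → 2 * (e + s * j) + 2 * (y + s) ≡ 2 * (e + y + s * suc j)
  regroup = ℕ-Solver.solve-∀

-- As `j = i * 2` is even, the signs are plus and minus; the step to `suc j` raises the exponent by
-- `exponentStep` and the width `c * s` by `2 * s`.
numerator-pair : ∀ r s k i → 2 * s < r → let j = i * 2; c = suc (2 * (k + j)) in
  numeratorTerm r s k j +ₚ numeratorTerm r s k (suc j) ≗
  q^ (exponent r s k j) *ₚ
    ((1ₚ -ₚ q^ (c * s)) -ₚ q^ (exponentStep r s k j) *ₚ (1ₚ -ₚ q^ (c * s + 2 * s)))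
numerator-pair r s k i 2s<r n = begin
  (-1ℤ ^ℤ j) ℤ.* (q^ e *ₚ (1ₚ -ₚ q^ (2 * j * s + (2 * k + 1) * s))) n ℤ.+
  (-1ℤ ℤ.* -1ℤ ^ℤ j) ℤ.* (q^ (exponent r s k (suc j)) *ₚ (1ₚ -ₚ q^ (2 * suc j * s + (2 * k + 1) * s))) n
    ≡⟨ cong₂ ℤ._+_ (cong₂ (λ x a → x ℤ.* (q^ e *ₚ (1ₚ -ₚ q^ a)) n) (-1^-even i) (width s k j))
         (cong₂ (λ x F → -1ℤ ℤ.* x ℤ.* F n) (-1^-even i)
           (cong₂ (λ a b → q^ a *ₚ (1ₚ -ₚ q^ b)) (exponent-suc r s k j 2s<r) (width′ s k j))) ⟩
  1ℤ ℤ.* (q^ e *ₚ (1ₚ -ₚ q^ (c * s))) n ℤ.+ -1ℤ ℤ.* (q^ (e + y) *ₚ (1ₚ -ₚ q^ (c * s + 2 * s))) n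
    ≡⟨ signs ((q^ e *ₚ (1ₚ -ₚ q^ (c * s))) n) ((q^ (e + y) *ₚ (1ₚ -ₚ q^ (c * s + 2 * s))) n) ⟩
  (q^ e *ₚ (1ₚ -ₚ q^ (c * s))) n ℤ.- (q^ (e + y) *ₚ (1ₚ -ₚ q^ (c * s + 2 * s))) n
    ≡⟨ cong (λ x → (q^ e *ₚ (1ₚ -ₚ q^ (c * s))) n ℤ.- x) (*-congʳ {1ₚ -ₚ q^ (c * s + 2 * s)} (q^-+ e y) n) ⟩
  (q^ e *ₚ (1ₚ -ₚ q^ (c * s))) n ℤ.- (q^ e *ₚ q^ y *ₚ (1ₚ -ₚ q^ (c * s + 2 * s))) n
    ≡⟨ solve 4 (λ e x y z → e :* x :- e :* y :* z := e :* (x :- y :* z)) ≗-refl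
         (q^ e) (1ₚ -ₚ q^ (c * s)) (q^ y) (1ₚ -ₚ q^ (c * s + 2 * s)) n ⟩
  (q^ e *ₚ ((1ₚ -ₚ q^ (c * s)) -ₚ q^ y *ₚ (1ₚ -ₚ q^ (c * s + 2 * s)))) n ∎
  where
  open ≡-Reasoning
  j c e y : ℕ
  j = i * 2
  c = suc (2 * (k + j))
  e = exponent r s k j
  y = exponentStep r s k j
  width : ∀ s k j → 2 * j * s + (2 * k + 1) * s ≡ suc (2 * (k + j)) * s
  width = ℕ-Solver.solve-∀
  width′ : ∀ s k j → 2 * suc j * s + (2 * k + 1) * s ≡ suc (2 * (k + j)) * s + 2 * s
  width′ = ℕ-Solver.solve-∀
  signs : ∀ a b → 1ℤ ℤ.* a ℤ.+ -1ℤ ℤ.* b ≡ a ℤ.- b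
  signs = ℤ-Solver.solve-∀

-- Nonnegativity of the numerator quotient for general coprime `u` and `v`

module Numerator
  (r s k u v : ℕ) (1≤s : 1 ≤ s) (2s<r : 2 * s < r) (8r+4≤k : 8 * r + 4 ≤ k)
  (0<u : 0 < u) (0<v : 0 < v) (coprime : Coprime v u) (vu≤2rr : v * u ≤ 2 * (r * r))
  where

  open Representations u v 0<u 0<v coprime

  private
    D : ℕ
    D = v * u

    -- For pair `i`, `y` is the exponent step inside the pair, `g` the step to the next pair,
    -- `c * s` the width, `κ` the guaranteed increment over `y`, `t` the degree where the loss sets
    -- in, and `W` the gain net of the constant error `2 * D`.
    y E g m c κ t W : ℕ → ℕ
    y i = exponentStep r s k (i * 2)
    E i = exponent r s k (i * 2)
    g i = y i + exponentStep r s k (suc (i * 2))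
    m i = k + i * 2
    c i = suc (2 * m i)
    κ i = y i ∸ 2 * D
    t i = c i * s + y i
    W i = c i * κ i ∸ 2 * D

    1≤r : 1 ≤ r
    1≤r = ≤-trans z<s 2s<r

    s≤r : s ≤ r
    s≤r = ≤-trans (m≤m+n s (s + 0)) (<⇒≤ 2s<r)

    rm≤y : ∀ i → r * m i ≤ y i
    rm≤y i = m+n≤o⇒m≤o∸n (r * m i) (≤-trans (+-monoʳ-≤ (r * m i) s≤r)
      (≤-reflexive (trans (+-comm (r * m i) r) (sym (*-suc r (m i))))))

    2D≤4rr : 2 * D ≤ 2 * (2 * (r * r))
    2D≤4rr = *-monoʳ-≤ 2 vu≤2rr

    -- Makes the truncated subtraction in `κ` exact: `2 D ≤ 4 r²`, while `y i` is at least `r k` and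
    -- `k` exceeds `8 r`.
    2D≤y : ∀ i → 2 * D ≤ y i
    2D≤y i = begin
      2 * D                 ≤⟨ 2D≤4rr ⟩
      2 * (2 * (r * r))     ≡⟨ regroup r ⟩
      r * (4 * r)
        ≤⟨ *-monoʳ-≤ r (≤-trans (*-monoˡ-≤ r (m≤m+n 4 4)) (≤-trans (m≤m+n (8 * r) 4) (≤-trans 8r+4≤k (m≤m+n k (i * 2))))) ⟩
      r * m i               ≤⟨ rm≤y i ⟩
      y i                   ∎
      where
      open ≤-Reasoning
      regroup : ∀ r → 2 * (2 * (r * r)) ≡ r * (4 * r)
      regroup = ℕ-Solver.solve-∀

    κ+2D≡y : ∀ i → κ i + 2 * D ≡ y i
    κ+2D≡y i = m∸n+n≡m (2D≤y i)

    -- The width is at most the second exponent step, because `c i * s + s = 2 s (m i + 1)` and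
    -- `2 s < r`.
    t≤g : ∀ i → t i ≤ g i
    t≤g i = subst (_≤ g i) (+-comm (y i) (c i * s)) (+-monoʳ-≤ (y i) (m+n≤o⇒m≤o∸n (c i * s) (begin
      c i * s + s                   ≡⟨ regroup (m i) s ⟩
      2 * s * suc (m i)             ≤⟨ *-mono-≤ (<⇒≤ 2s<r) (s≤s (+-monoʳ-≤ k (n≤1+n (i * 2)))) ⟩
      r * suc (k + suc (i * 2))     ∎)))
      where
      open ≤-Reasoning
      regroup : ∀ m s → suc (2 * m) * s + s ≡ 2 * s * suc m
      regroup = ℕ-Solver.solve-∀

    step-mono : ∀ {j j′} → j ≤ j′ → exponentStep r s k j ≤ exponentStep r s k j′
    step-mono j≤j′ = ∸-monoˡ-≤ s (*-monoʳ-≤ r (s≤s (+-monoʳ-≤ k j≤j′)))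

    g-mono : ∀ i → g i ≤ g (suc i)
    g-mono i = +-mono-≤ (step-mono (m≤n+m (i * 2) 2)) (step-mono (m≤n+m (suc (i * 2)) 2))

    g-suc-≤ : ∀ i → g (suc i) ≤ r * (2 * m i + 7)
    g-suc-≤ i = ≤-trans (+-mono-≤ (m∸n≤m (r * suc (k + suc (suc (i * 2)))) s) (m∸n≤m (r * suc (k + suc (suc (suc (i * 2))))) s))
      (≤-reflexive (regroup r k i))
      where
      regroup : ∀ r k i → r * suc (k + suc (suc (i * 2))) + r * suc (k + suc (suc (suc (i * 2)))) ≡ r * (2 * (k + i * 2) + 7)
      regroup = ℕ-Solver.solve-∀

    -- Since `m i = k + 2 i`, the main part of the difference of the two sides is
    -- `2 r m (k - 4 r - 4)`, and `8 r + 4 ≤ k` leaves room for the rest. In terms of `r = 1 + ρ`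
    -- and `k = 8 r + 4 + τ` the difference has only nonnegative coefficients.
    cy-lower : ∀ i → (2 * i + 4) * (r * (2 * m i + 7)) + suc (c i) * (2 * (2 * (r * r))) ≤ c i * (r * m i)
    cy-lower i = subst₂ P 1+ρ≡r
      (trans (cong (λ r → 8 * r + 4 + τ) 1+ρ≡r) (m+[n∸m]≡n 8r+4≤k))
      (m+n≤o⇒m≤o _ (≤-reflexive (identity ρ i τ)))
      where
      ρ τ : ℕ
      ρ = r ∸ 1
      τ = k ∸ (8 * r + 4)
      1+ρ≡r : 1 + ρ ≡ r
      1+ρ≡r = m+[n∸m]≡n 1≤r
      P : ℕ → ℕ → Set
      P r k = (2 * i + 4) * (r * (2 * (k + i * 2) + 7)) + suc (suc (2 * (k + i * 2))) * (2 * (2 * (r * r)))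
              ≤ suc (2 * (k + i * 2)) * (r * (k + i * 2))
      identity : ∀ ρ i τ → let r = 1 + ρ; k = 8 * (1 + ρ) + 4 + τ; m = k + i * 2 in
        (2 * i + 4) * (r * (2 * m + 7)) + suc (suc (2 * m)) * (2 * (2 * (r * r))) +
        r * (suc (2 * m) * τ + 2 * (2 * i + 4) + 8 * (8 * r + τ) + 8 * ρ * m)
        ≡ suc (2 * m) * (r * m)
      identity = ℕ-Solver.solve-∀

    -- Adding `c i * (2 * D)` to both sides replaces `κ i` by `y i` and reduces the claim to
    -- `cy-lower`. The extra `2 * D` is the one subtracted in `W`.
    cκ-lower : ∀ i → (2 * i + 4) * g (suc i) + 2 * D ≤ c i * κ i
    cκ-lower i = +-cancelʳ-≤ (c i * (2 * D)) ((2 * i + 4) * g (suc i) + 2 * D) (c i * κ i) (begin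
      (2 * i + 4) * g (suc i) + 2 * D + c i * (2 * D)
        ≡⟨ +-assoc ((2 * i + 4) * g (suc i)) (2 * D) (c i * (2 * D)) ⟩
      (2 * i + 4) * g (suc i) + suc (c i) * (2 * D)
        ≤⟨ +-mono-≤ (*-monoʳ-≤ (2 * i + 4) (g-suc-≤ i)) (*-monoʳ-≤ (suc (c i)) 2D≤4rr) ⟩
      (2 * i + 4) * (r * (2 * m i + 7)) + suc (c i) * (2 * (2 * (r * r)))
        ≤⟨ cy-lower i ⟩
      c i * (r * m i)
        ≤⟨ *-monoʳ-≤ (c i) (rm≤y i) ⟩
      c i * y i
        ≡⟨ cong (c i *_) (κ+2D≡y i) ⟨
      c i * (κ i + 2 * D)
        ≡⟨ *-distribˡ-+ (c i) (κ i) (2 * D) ⟩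
      c i * κ i + c i * (2 * D) ∎)
      where open ≤-Reasoning

    -- Replacing `g i` by the larger `g (suc i)` collects the left side into `(2 i + 4) g (suc i)`.
    W-lower : ∀ i → 2 * i * g (suc i) + 2 * (g i + g (suc i)) ≤ W i
    W-lower i = ≤-trans (≤-trans
      (+-monoʳ-≤ (2 * i * g (suc i)) (*-monoʳ-≤ 2 (+-monoˡ-≤ (g (suc i)) (g-mono i))))
      (≤-reflexive (regroup i (g (suc i)))))
      (m+n≤o⇒m≤o∸n ((2 * i + 4) * g (suc i)) (cκ-lower i))
      where
      regroup : ∀ i g → 2 * i * g + 2 * (g + g) ≡ (2 * i + 4) * g
      regroup = ℕ-Solver.solve-∀

    -- The `y` of `Increments` becomes `κ i + 2 * D`, which agrees with `y i` only through `κ+2D≡y`;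
    -- hence the transports below.
    module Inc (i : ℕ) = Increments (κ i)

    Q : ℕ → PowerSeries
    Q i = Inc.pairQuotient i s (c i)

    Q-nonneg : ∀ i {n} → n < t i → 0ℤ ℤ.≤ Q i n
    Q-nonneg i {n} n<t = Inc.pairQuotient-nonneg i s (c i) (subst (λ y → n < c i * s + y) (sym (κ+2D≡y i)) n<t)

    Q-lower : ∀ i {n} → t i ≤ n → + W i ℤ.≤ + D ℤ.* Q i n ℤ.+ + (2 * n)
    Q-lower i {n} t≤n = begin
      + W i
        ≡⟨ lemma₁ (+ W i) (+ (2 * D)) ⟩
      + (W i + 2 * D) ℤ.- + (2 * D)
        ≡⟨ cong (λ x → + x ℤ.- + (2 * D)) (m∸n+n≡m (≤-trans (m≤n+m (2 * D) ((2 * i + 4) * g (suc i))) (cκ-lower i))) ⟩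
      + (c i * κ i) ℤ.- + (2 * D)
        ≤⟨ ℤ.+-monoˡ-≤ (ℤ.- + (2 * D)) (Inc.pairQuotient-lower i s (c i) (subst (λ y → c i * s + y ≤ n) (sym (κ+2D≡y i)) t≤n)) ⟩
      + D ℤ.* Q i n ℤ.+ + (2 * (n + D)) ℤ.- + (2 * D)
        ≡⟨ cong (λ x → + D ℤ.* Q i n ℤ.+ + x ℤ.- + (2 * D)) (*-distribˡ-+ 2 n D) ⟩
      + D ℤ.* Q i n ℤ.+ (+ (2 * n) ℤ.+ + (2 * D)) ℤ.- + (2 * D)
        ≡⟨ lemma₂ (+ D ℤ.* Q i n) (+ (2 * n)) (+ (2 * D)) ⟩
      + D ℤ.* Q i n ℤ.+ + (2 * n) ∎
      where
      open ℤ.≤-Reasoning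
      lemma₁ : ∀ a b → a ≡ a ℤ.+ b ℤ.- b
      lemma₁ = ℤ-Solver.solve-∀
      lemma₂ : ∀ a b c → a ℤ.+ (b ℤ.+ c) ℤ.- c ≡ a ℤ.+ b
      lemma₂ = ℤ-Solver.solve-∀

    E-suc : ∀ i → E (suc i) ≡ E i + g i
    E-suc i = trans (exponent-suc r s k (suc (i * 2)) 2s<r)
      (trans (cong (_+ exponentStep r s k (suc (i * 2))) (exponent-suc r s k (i * 2) 2s<r))
        (+-assoc (E i) (y i) (exponentStep r s k (suc (i * 2)))))

  open ShiftedSum D (*-mono-< 0<v 0<u) E g t W Q E-suc t≤g Q-nonneg Q-lower W-lower

  denominator : PowerSeries
  denominator = (1ₚ -ₚ q^ s) *ₚ (1ₚ -ₚ q^ u) *ₚ (1ₚ -ₚ q^ v)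

  denominator-constant : denominator 0 ≡ 1ℤ
  denominator-constant = *ₚ-constant ((1ₚ -ₚ q^ s) *ₚ (1ₚ -ₚ q^ u)) (1ₚ -ₚ q^ v)
    (*ₚ-constant (1ₚ -ₚ q^ s) (1ₚ -ₚ q^ u) (1-q^-constant 1≤s) (1-q^-constant 0<u)) (1-q^-constant 0<v)

  -- For each pair, `pairQuotient-*ₚ` undoes the division and `numerator-pair` recognises two
  -- consecutive numerator terms.
  shiftedSum-*ₚ : ∀ N → shiftedSum E Q N *ₚ denominator ≗ λ n → ∑[ j < N * 2 ] numeratorTerm r s k (toℕ j) n
  shiftedSum-*ₚ zero    n = solve 1 (λ d → con 0ℤ :* d := con 0ℤ) ≗-refl denominator n
  shiftedSum-*ₚ (suc N) n = begin
    ((shiftedSum E Q N +ₚ q^ (E N) *ₚ Q N) *ₚ denominator) n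
      ≡⟨ solve 4 (λ x e q d → (x :+ e :* q) :* d := x :* d :+ e :* (q :* d)) ≗-refl
           (shiftedSum E Q N) (q^ (E N)) (Q N) denominator n ⟩
    (shiftedSum E Q N *ₚ denominator) n ℤ.+ (q^ (E N) *ₚ (Q N *ₚ denominator)) n
      ≡⟨ cong₂ ℤ._+_ (shiftedSum-*ₚ N n) (*-congˡ {q^ (E N)} (Inc.pairQuotient-*ₚ N s (c N)) n) ⟩
    previous ℤ.+ (q^ (E N) *ₚ ((1ₚ -ₚ q^ (c N * s)) -ₚ q^ (κ N + 2 * D) *ₚ (1ₚ -ₚ q^ (c N * s + 2 * s)))) n
      ≡⟨ cong (λ y → previous ℤ.+ (q^ (E N) *ₚ ((1ₚ -ₚ q^ (c N * s)) -ₚ q^ y *ₚ (1ₚ -ₚ q^ (c N * s + 2 * s)))) n) (κ+2D≡y N) ⟩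
    previous ℤ.+ (q^ (E N) *ₚ ((1ₚ -ₚ q^ (c N * s)) -ₚ q^ (y N) *ₚ (1ₚ -ₚ q^ (c N * s + 2 * s)))) n
      ≡⟨ cong (λ x → previous ℤ.+ x) (numerator-pair r s k N 2s<r n) ⟨
    previous ℤ.+ (term (N * 2) ℤ.+ term (suc (N * 2)))
      ≡⟨ ℤ.+-assoc previous (term (N * 2)) (term (suc (N * 2))) ⟨
    previous ℤ.+ term (N * 2) ℤ.+ term (suc (N * 2))
      ≡⟨ cong (ℤ._+ term (suc (N * 2))) (sum-snoc term (N * 2)) ⟨
    (∑[ j < suc (N * 2) ] term (toℕ j)) ℤ.+ term (suc (N * 2))
      ≡⟨ sum-snoc term (suc (N * 2)) ⟨
    ∑[ j < suc N * 2 ] term (toℕ j) ∎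
    where
    open ≡-Reasoning
    term : ℕ → ℤ
    term j = numeratorTerm r s k j n
    previous : ℤ
    previous = ∑[ j < N * 2 ] term (toℕ j)

  numerator/denominator-nonneg : Nonnegative (numerator r s k /ₚ denominator)
  numerator/denominator-nonneg n = subst (0ℤ ℤ.≤_) (sym coefficient) (shiftedSum-nonneg N (begin
    n                    ≤⟨ n≤1+n n ⟩
    N                    ≤⟨ m≤m*n N 2 ⟩
    N * 2                ≤⟨ m≤n+m (N * 2) 2 ⟩
    suc N * 2            ≤⟨ exponent-≥ r s k (suc N * 2) 2s<r ⟩
    E (suc N)            ∎))
    where
    open ≤-Reasoning
    -- With `suc n` pairs, the omitted terms have index above `n` and do not reach degree `n`, and
    -- `n ≤ E (suc N)` holds as `shiftedSum-nonneg` demands.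
    N : ℕ
    N = suc n
    coefficient : (numerator r s k /ₚ denominator) n ≡ shiftedSum E Q N n
    coefficient = trans
      (/ₚ-local n
        (λ {i} i≤n → trans (sym (numerator-converges r s k 2s<r (≤-trans (s≤s i≤n) (m≤m*n N 2)))) (sym (shiftedSum-*ₚ N i)))
        (λ _ → refl))
      (sym (quotient-unique (shiftedSum E Q N) (shiftedSum E Q N *ₚ denominator) denominator denominator-constant ≗-refl n))

-- The tail series

-- Serves to move both the sign `(-1)^k` and the factor `q^C` across truncated sums.
sum-homo : ∀ (φ : PowerSeries → ℤ) → φ 0ₚ ≡ 0ℤ → (∀ F G → φ (F +ₚ G) ≡ φ F ℤ.+ φ G) →
           ∀ f m → φ (λ n → ∑[ j < m ] f (toℕ j) n) ≡ ∑[ j < m ] φ (f (toℕ j))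
sum-homo φ φ-zero φ-+ f zero    = φ-zero
sum-homo φ φ-zero φ-+ f (suc m) = trans (φ-+ (f 0) (λ n → ∑[ j < m ] f (suc (toℕ j)) n))
  (cong (λ x → φ (f 0) ℤ.+ x) (sum-homo φ φ-zero φ-+ (f ∘ suc) m))

-1^-square : ∀ k → -1ℤ ^ℤ k ℤ.* -1ℤ ^ℤ k ≡ 1ℤ
-1^-square zero    = refl
-1^-square (suc k) = trans (lemma (-1ℤ ^ℤ k)) (-1^-square k)
  where
  lemma : ∀ x → -1ℤ ℤ.* x ℤ.* (-1ℤ ℤ.* x) ≡ x ℤ.* x
  lemma = ℤ-Solver.solve-∀

-- Rests on `(k + i)² + (k + i) = (k² + k) + (i² + (2 k + 1) i)`, which is how a tail exponent
-- splits into a constant and a numerator exponent.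
exponent-+ : ∀ r s k i → 2 * s < r → exponent r s 0 (k + i) ≡ exponent r s 0 k + exponent r s k i
exponent-+ r s k i 2s<r = +-cancelʳ-≡ (s * (k + i)) a (b + c)
  (*-cancelˡ-≡ (a + s * (k + i)) (b + c + s * (k + i)) 2 (begin
  2 * (a + s * (k + i))                      ≡⟨ exponent-exact r s 0 (k + i) 2s<r ⟩
  r * ((k + i) ^ 2 + (2 * 0 + 1) * (k + i))  ≡⟨ expand r k i ⟩
  r * (k ^ 2 + (2 * 0 + 1) * k) + r * (i ^ 2 + (2 * k + 1) * i)
    ≡⟨ cong₂ _+_ (exponent-exact r s 0 k 2s<r) (exponent-exact r s k i 2s<r) ⟨
  2 * (b + s * k) + 2 * (c + s * i)          ≡⟨ regroup b c s k i ⟩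
  2 * (b + c + s * (k + i))                  ∎))
  where
  open ≡-Reasoning
  a = exponent r s 0 (k + i)
  b = exponent r s 0 k
  c = exponent r s k i
  expand : ∀ r k i → r * ((k + i) * ((k + i) * 1) + 1 * (k + i)) ≡
                     r * (k * (k * 1) + 1 * k) + r * (i * (i * 1) + (2 * k + 1) * i)
  expand = ℕ-Solver.solve-∀
  regroup : ∀ b c s k i → 2 * (b + s * k) + 2 * (c + s * i) ≡ 2 * (b + c + s * (k + i))
  regroup = ℕ-Solver.solve-∀

tailTerm-low : ∀ r s j → r * (j * (j + 1)) /ℕ 2 ∸ s * j ≡ exponent r s 0 j
tailTerm-low r s j = cong (λ x → r * x /ℕ 2 ∸ s * j) (j[j+1] j)

-- With `M = k + i`, the two exponents of a tail term differ by `s M + (M + 1) s = (2 M + 1) s`, the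
-- width of the numerator term.
tailTerm-high : ∀ r s k i → 2 * s < r →
  r * ((k + i) * (k + i + 1)) /ℕ 2 + (k + i + 1) * s ≡ exponent r s 0 (k + i) + (2 * i * s + (2 * k + 1) * s)
tailTerm-high r s k i 2s<r = begin
  h + (M + 1) * s
    ≡⟨ cong (_+ (M + 1) * s) (m∸n+n≡m (m+n≤o⇒n≤o M (proj₂ (tailExponent-exact r s M 2s<r)))) ⟨
  h ∸ s * M + s * M + (M + 1) * s                          ≡⟨ cong (λ e → e + s * M + (M + 1) * s) (tailTerm-low r s M) ⟩
  exponent r s 0 M + s * M + (M + 1) * s                   ≡⟨ regroup (exponent r s 0 M) s k i ⟩
  exponent r s 0 M + (2 * i * s + (2 * k + 1) * s)         ∎
  where
  open ≡-Reasoning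
  M h : ℕ
  M = k + i
  h = r * (M * (M + 1)) /ℕ 2
  regroup : ∀ e s k i → e + s * (k + i) + (k + i + 1) * s ≡ e + (2 * i * s + (2 * k + 1) * s)
  regroup = ℕ-Solver.solve-∀

-- The signs combine to `(-1)^i` because `(-1)^k` squares to 1, and by `exponent-+` both powers of q
-- contain `q^C`.
tailTerm-numeratorTerm : ∀ r s k i → 2 * s < r →
  (-1ℤ ^ℤ k) · tailTerm r s (k + i) ≗ q^ (exponent r s 0 k) *ₚ numeratorTerm r s k i
tailTerm-numeratorTerm r s k i 2s<r n = begin
  σ ℤ.* (-1ℤ ^ℤ (k + i) ℤ.* ((q^ a) n ℤ.- (q^ b) n))
    ≡⟨ cong₂ (λ x y → σ ℤ.* (x ℤ.* y)) (ℤ.^-distribˡ-+-* -1ℤ k i) factored ⟩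
  σ ℤ.* (σ ℤ.* τ ℤ.* (q^ C *ₚ F) n)
    ≡⟨ regroup σ τ ((q^ C *ₚ F) n) ⟩
  (σ ℤ.* σ) ℤ.* (τ ℤ.* (q^ C *ₚ F) n)
    ≡⟨ cong (ℤ._* (τ ℤ.* (q^ C *ₚ F) n)) (-1^-square k) ⟩
  1ℤ ℤ.* (τ ℤ.* (q^ C *ₚ F) n)
    ≡⟨ ℤ.*-identityˡ (τ ℤ.* (q^ C *ₚ F) n) ⟩
  τ ℤ.* (q^ C *ₚ F) n
    ≡⟨ cong (τ ℤ.*_) (*ₚ-comm (q^ C) F n) ⟩
  τ ℤ.* (F *ₚ q^ C) n
    ≡⟨ ·-*ₚ τ F (q^ C) n ⟨
  ((τ · F) *ₚ q^ C) n
    ≡⟨ *ₚ-comm (τ · F) (q^ C) n ⟩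
  (q^ C *ₚ numeratorTerm r s k i) n ∎
  where
  open ≡-Reasoning
  a b C e w : ℕ
  a = r * ((k + i) * (k + i + 1)) /ℕ 2 ∸ s * (k + i)
  b = r * ((k + i) * (k + i + 1)) /ℕ 2 + (k + i + 1) * s
  C = exponent r s 0 k
  e = exponent r s k i
  w = 2 * i * s + (2 * k + 1) * s
  σ τ : ℤ
  σ = -1ℤ ^ℤ k
  τ = -1ℤ ^ℤ i
  F : PowerSeries
  F = q^ e *ₚ (1ₚ -ₚ q^ w)
  a≡ : a ≡ C + e
  a≡ = trans (tailTerm-low r s (k + i)) (exponent-+ r s k i 2s<r)
  b≡ : b ≡ C + e + w
  b≡ = trans (tailTerm-high r s k i 2s<r) (cong (_+ w) (exponent-+ r s k i 2s<r))
  regroup : ∀ σ τ x → σ ℤ.* (σ ℤ.* τ ℤ.* x) ≡ (σ ℤ.* σ) ℤ.* (τ ℤ.* x)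
  regroup = ℤ-Solver.solve-∀
  factored : (q^ a) n ℤ.- (q^ b) n ≡ (q^ C *ₚ F) n
  factored = begin
    (q^ a) n ℤ.- (q^ b) n                ≡⟨ cong₂ (λ a b → (q^ a) n ℤ.- (q^ b) n) a≡ b≡ ⟩
    (q^ (C + e)) n ℤ.- (q^ (C + e + w)) n
      ≡⟨ cong₂ ℤ._-_ (q^-+ C e n) (trans (q^-+ (C + e) w n) (*-congʳ {q^ w} (q^-+ C e) n)) ⟩
    (q^ C *ₚ q^ e) n ℤ.- (q^ C *ₚ q^ e *ₚ q^ w) n
      ≡⟨ solve 3 (λ c e w → c :* e :- c :* e :* w := c :* (e :* (con 1ℤ :- w))) ≗-refl (q^ C) (q^ e) (q^ w) n ⟩
    (q^ C *ₚ F) n ∎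

tailSum-numerator : ∀ r s k → 2 * s < r →
  (-1ℤ ^ℤ k) · tailSum r s k ≗ q^ (exponent r s 0 k) *ₚ numerator r s k
tailSum-numerator r s k 2s<r n = begin
  σ ℤ.* tailSum r s k n
    ≡⟨ sum-homo (λ F → σ ℤ.* F n) (ℤ.*-zeroʳ σ) (λ F G → ℤ.*-distribˡ-+ σ (F n) (G n)) (λ i → tailTerm r s (k + i)) (suc n) ⟩
  ∑[ i < suc n ] (σ ℤ.* tailTerm r s (k + toℕ i) n)
    ≡⟨ sum-cong-≗ {suc n} (λ i → tailTerm-numeratorTerm r s k (toℕ i) 2s<r n) ⟩
  ∑[ i < suc n ] ((q^ C *ₚ numeratorTerm r s k (toℕ i)) n)
    ≡⟨ sum-homo (λ F → (q^ C *ₚ F) n) (zeroʳ (q^ C) n)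
         (λ F G → distribˡ (q^ C) F G n) (numeratorTerm r s k) (suc n) ⟨
  -- The same `suc n` terms give every coefficient of the numerator up to degree `n`, which is all
  -- that the product uses.
  (q^ C *ₚ (λ n → ∑[ i < N ] numeratorTerm r s k (toℕ i) n)) n
    ≡⟨ *ₚ-local n {q^ C} (λ _ → refl) (λ i≤n → numerator-converges r s k 2s<r (s≤s i≤n)) ⟩
  (q^ C *ₚ numerator r s k) n ∎
  where
  open ≡-Reasoning
  σ : ℤ
  σ = -1ℤ ^ℤ k
  C N : ℕ
  C = exponent r s 0 k
  N = suc n

-- Division by the infinite products

/ₚ-congʳ : ∀ {F G G′} → G ≗ G′ → F /ₚ G ≗ F /ₚ G′
/ₚ-congʳ G≗G′ n = /ₚ-local n (λ _ → refl) (λ {i} _ → G≗G′ i)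

Nonnegative-resp : ∀ {F G} → F ≗ G → Nonnegative F → Nonnegative G
Nonnegative-resp F≗G 0≤F n = subst (0ℤ ℤ.≤_) (F≗G n) (0≤F n)

-- The inverse of the new factor is the nonnegative series `multiples a`.
/ₚ-factor-nonneg : ∀ {F G a} → G 0 ≡ 1ℤ → 0 < a → Nonnegative (F /ₚ G) → Nonnegative (F /ₚ (G *ₚ (1ₚ -ₚ q^ a)))
/ₚ-factor-nonneg {F} {G} {a} G₀≡1 0<a 0≤F/G =
  Nonnegative-resp (/ₚ-*ₚ-unit F {G} {1ₚ -ₚ q^ a} {multiples a} G₀≡1 (1-q^-constant 0<a) (multiples-inverse 0<a))
    (*ₚ-nonneg 0≤F/G (multiples-nonneg a))

pochhammer : ℕ → ℕ → ℕ → PowerSeries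
pochhammer a b m = ∏< m (λ j → 1ₚ -ₚ q^ (a + b * j))

pochhammer-constant : ∀ {a} b m → 0 < a → pochhammer a b m 0 ≡ 1ℤ
pochhammer-constant b zero    0<a = refl
pochhammer-constant {a} b (suc m) 0<a = *ₚ-constant (pochhammer a b m) (1ₚ -ₚ q^ (a + b * m))
  (pochhammer-constant b m 0<a) (1-q^-constant (≤-trans 0<a (m≤m+n a (b * m))))

pochhammer-converges : ∀ {a b m} → 0 < a → 0 < b → ∀ {i} → i < m → ⟨q^ a ⨾q^ b ⟩∞ i ≡ pochhammer a b m i
pochhammer-converges {a} {b} {m} 0<a 0<b {i} i<m = trans
  (sym (qPochhammer-converges 0<a 0<b (m ∸ suc i))) (cong (λ m → pochhammer a b m i) (m∸n+n≡m i<m))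

module _ {F : PowerSeries} {a b c : ℕ} (0<a : 0 < a) (0<b : 0 < b) (0<c : 0 < c) where

  -- Starts from two factors of each product because these include the three factors of either case;
  -- each further step divides by one more factor from each product.
  /ₚ-pochhammer-nonneg : Nonnegative (F /ₚ (pochhammer a c 2 *ₚ pochhammer b c 2)) →
    ∀ m → Nonnegative (F /ₚ (pochhammer a c (2 + m) *ₚ pochhammer b c (2 + m)))
  /ₚ-pochhammer-nonneg base zero    = base
  /ₚ-pochhammer-nonneg base (suc m) = Nonnegative-resp (/ₚ-congʳ {F}
      (solve 4 (λ p q x y → (p :* q) :* x :* y := (p :* x) :* (q :* y)) ≗-refl
        A B (1ₚ -ₚ q^ (a + c * (2 + m))) (1ₚ -ₚ q^ (b + c * (2 + m)))))
    (/ₚ-factor-nonneg {F} {(A *ₚ B) *ₚ (1ₚ -ₚ q^ (a + c * (2 + m)))}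
      (*ₚ-constant (A *ₚ B) (1ₚ -ₚ q^ (a + c * (2 + m))) AB₀≡1 (1-q^-constant 0<a′)) 0<b′
      (/ₚ-factor-nonneg {F} {A *ₚ B} AB₀≡1 0<a′ (/ₚ-pochhammer-nonneg base m)))
    where
    A B : PowerSeries
    A = pochhammer a c (2 + m)
    B = pochhammer b c (2 + m)
    AB₀≡1 : (A *ₚ B) 0 ≡ 1ℤ
    AB₀≡1 = *ₚ-constant A B (pochhammer-constant c (2 + m) 0<a) (pochhammer-constant c (2 + m) 0<b)
    0<a′ : 0 < a + c * (2 + m)
    0<a′ = ≤-trans 0<a (m≤m+n a (c * (2 + m)))
    0<b′ : 0 < b + c * (2 + m)
    0<b′ = ≤-trans 0<b (m≤m+n b (c * (2 + m)))

  -- Coefficient `n` of the quotient sees the products only up to degree `n`, where `2 + n` factors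
  -- determine them.
  /ₚ-infinite-nonneg : Nonnegative (F /ₚ (pochhammer a c 2 *ₚ pochhammer b c 2)) →
    Nonnegative (F /ₚ (⟨q^ a ⨾q^ c ⟩∞ *ₚ ⟨q^ b ⨾q^ c ⟩∞))
  /ₚ-infinite-nonneg base n = subst (0ℤ ℤ.≤_)
    (/ₚ-local n {F} (λ _ → refl) (λ {i} i≤n → sym (*ₚ-local i
      (λ j≤i → pochhammer-converges 0<a 0<c (s≤s (≤-trans j≤i (≤-trans i≤n (n≤1+n n)))))
      (λ j≤i → pochhammer-converges 0<b 0<c (s≤s (≤-trans j≤i (≤-trans i≤n (n≤1+n n))))))))
    (/ₚ-pochhammer-nonneg base n n)

-- Arithmetic of the hypotheses

-- Cleared of denominators, with `w = r - 2 s`, the bound reads `c r³ s < k r w + 2 s w`. If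
-- `k ≤ 8 r + 3`, the right side would be at most `8 r³`, hence at most `c r³ s`.
bound⇒8r+4≤k : ∀ c r s k → 1 ≤ s → (2s<r : 2 * s < r) → 8 ≤ c * s → + k / 1 > bound c r s 2s<r → 8 * r + 4 ≤ k
bound⇒8r+4≤k c r s k 1≤s 2s<r 8≤cs (*<* bound<k) = ≮⇒≥ λ k<8r+4 → <⇒≱ crrrs<krw+2sw (begin
  k * (r * w) + 2 * s * w
    ≤⟨ +-monoˡ-≤ (2 * s * w) (*-monoˡ-≤ (r * w) (m<1+n⇒m≤n (subst (k <_) (+-suc (8 * r) 3) k<8r+4))) ⟩
  (8 * r + 3) * (r * w) + 2 * s * w         ≤⟨ arithmetic ⟩
  8 * (r * (r * (r * 1)))                   ≤⟨ *-monoˡ-≤ (r * (r * (r * 1))) 8≤cs ⟩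
  c * s * (r * (r * (r * 1)))               ≡⟨ regroup c s (r * (r * (r * 1))) ⟩
  c * (r * (r * (r * 1))) * s               ∎)
  where
  open ≤-Reasoning
  w = r ∸ 2 * s
  crrrs<krw+2sw : c * (r ^ 3) * s < k * (r * w) + 2 * s * w
  crrrs<krw+2sw = ℤ.drop‿+<+ (subst₂ ℤ._<_ (cancel (+ (c * r ^ 3 * s)) (+ (2 * s * w))) refl
    (ℤ.+-monoˡ-< (+ (2 * s * w)) (subst₂ ℤ._<_ lhs rhs bound<k)))
    where
    instance
      rw-nonZero : NonZero (r * w)
      rw-nonZero = denominator-nonZero {r} {s} 2s<r
    x : ℤ
    x = + (c * r ^ 3 * s) ℤ.- + (2 * s * w)
    lhs = trans (ℤ.*-identityʳ _) (↥[n/d]≡n x (r * w))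
    rhs = trans (cong (+ k ℤ.*_) (↧[n/d]≡d x (r * w))) (sym (ℤ.pos-* k (r * w)))
    cancel : ∀ a b → a ℤ.- b ℤ.+ b ≡ a
    cancel = ℤ-Solver.solve-∀
  regroup : ∀ c s x → c * s * x ≡ c * x * s
  regroup = ℕ-Solver.solve-∀
  -- Because `w = r - 2 s`, this amounts to `3 r w + 2 s w ≤ 16 r² s`. Substituting `s = 1 + σ` and
  -- `r = w + 2 s` makes the slack visibly nonnegative.
  arithmetic : (8 * r + 3) * (r * w) + 2 * s * w ≤ 8 * (r * (r * (r * 1)))
  arithmetic = subst₂ (λ r s → (8 * r + 3) * (r * w) + 2 * s * w ≤ 8 * (r * (r * (r * 1))))
    (trans (cong (λ s → w + 2 * s) 1+σ≡s) (m∸n+n≡m (<⇒≤ 2s<r))) 1+σ≡s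
    (m+n≤o⇒m≤o _ (≤-reflexive (identity w σ)))
    where
    σ : ℕ
    σ = s ∸ 1
    1+σ≡s : 1 + σ ≡ s
    1+σ≡s = m+[n∸m]≡n 1≤s
    identity : ∀ w σ → let s = 1 + σ; r = w + 2 * s in
      (8 * r + 3) * (r * w) + 2 * s * w + (16 * (r * r) * σ + 13 * (w * w) + 56 * (s * w) + 64 * (s * s)) ≡
      8 * (r * (r * (r * 1)))
    identity = ℕ-Solver.solve-∀

2∤⇒1 : ∀ {d} → d ∣ 2 → 2 ∤ d → d ≡ 1
2∤⇒1 {d} d∣2 2∤d with d | ∣⇒≤ d∣2
... | 0             | _           = contradiction (2 ∣0) 2∤d
... | 1             | _           = refl
... | 2             | _           = contradiction ∣-refl 2∤d
... | suc (suc (suc _)) | s≤s (s≤s ())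

-- A common divisor divides `2 r` and `2 s`, hence 2. It is not 2 itself, for then `r - s` and `s`,
-- and with them `r`, would be even.
coprime-r+s : ∀ {r s} → Coprime r s → s ≤ r → 2 ∣ s → Coprime (r + s) (r ∸ s)
coprime-r+s {r} {s} coprime s≤r 2∣s {d} (d∣r+s , d∣r∸s) =
  2∤⇒1 (coprime-factors coprime (d∣r*2 , d∣s*2)) λ 2∣d →
    contradiction (coprime (subst (2 ∣_) (m∸n+n≡m s≤r) (∣m∣n⇒∣m+n (∣-trans 2∣d d∣r∸s) 2∣s) , 2∣s)) λ ()
  where
  u = r ∸ s
  double : ∀ u s → (u + s + s) + u ≡ (u + s) * 2
  double = ℕ-Solver.solve-∀
  difference : ∀ u s → u + s + s ≡ u + s * 2
  difference = ℕ-Solver.solve-∀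
  d∣u+s+s : d ∣ u + s + s
  d∣u+s+s = subst (λ r → d ∣ r + s) (sym (m∸n+n≡m s≤r)) d∣r+s
  d∣r*2 : d ∣ r * 2
  d∣r*2 = subst (d ∣_) (trans (double u s) (cong (_* 2) (m∸n+n≡m s≤r))) (∣m∣n⇒∣m+n d∣u+s+s d∣r∸s)
  d∣s*2 : d ∣ s * 2
  d∣s*2 = ∣m+n∣m⇒∣n (subst (d ∣_) (difference u s) d∣u+s+s) d∣r∸s

2r∸s≡r∸s+r : ∀ {r s} → s ≤ r → 2 * r ∸ s ≡ (r ∸ s) + r
2r∸s≡r∸s+r {r} {s} s≤r = trans (cong (λ x → r + x ∸ s) (+-identityʳ r)) (+-∸-comm r s≤r)

-- The two numbers differ by `r`, and `r` and `r - s` differ by `s`.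
coprime-2r∸s : ∀ {r s} → Coprime r s → s ≤ r → Coprime (2 * r ∸ s) (r ∸ s)
coprime-2r∸s {r} {s} coprime s≤r {d} (d∣2r∸s , d∣r∸s) = coprime (d∣r , d∣s)
  where
  d∣r : d ∣ r
  d∣r = ∣m+n∣m⇒∣n (subst (d ∣_) (2r∸s≡r∸s+r s≤r) d∣2r∸s) d∣r∸s
  d∣s : d ∣ s
  d∣s = ∣m+n∣m⇒∣n (subst (d ∣_) (sym (m∸n+n≡m s≤r)) d∣r) d∣r∸s

-- The two cases and the tail series

module Main (r s k : ℕ) (1≤s : 1 ≤ s) (coprime : Coprime r s) (2s<r : 2 * s < r) where

  private
    s<r : s < r
    s<r = ≤-<-trans (m≤m+n s (s + 0)) 2s<r

    s≤r : s ≤ r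
    s≤r = <⇒≤ s<r

    0<r∸s : 0 < r ∸ s
    0<r∸s = m<n⇒0<n∸m s<r

    0<r : 0 < r
    0<r = ≤-<-trans z≤n s<r

    A U S V : PowerSeries
    A = 1ₚ -ₚ q^ s
    U = 1ₚ -ₚ q^ (r ∸ s)
    S = 1ₚ -ₚ q^ (r + s)
    V = 1ₚ -ₚ q^ (2 * r ∸ s)

    0<r+s : 0 < r + s
    0<r+s = ≤-trans 0<r (m≤m+n r s)

    0<2r∸s : 0 < 2 * r ∸ s
    0<2r∸s = subst (0 <_) (sym (2r∸s≡r∸s+r s≤r)) (≤-trans 0<r (m≤n+m r (r ∸ s)))

    2r*r : (2 * r) * r ≡ 2 * (r * r)
    2r*r = *-assoc 2 r r

  case₁ : 2 ∣ s → + k / 1 > bound 4 r s 2s<r → Nonnegative (numerator r s k /ₚ (A *ₚ U *ₚ S))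
  case₁ 2∣s bound<k = Numerator.numerator/denominator-nonneg r s k (r ∸ s) (r + s) 1≤s 2s<r
    -- A positive even `s` is at least 2, which gives `8 ≤ 4 s`.
    (bound⇒8r+4≤k 4 r s k 1≤s 2s<r (*-monoʳ-≤ 4 (∣⇒≤ {{>-nonZero 1≤s}} 2∣s)) bound<k)
    0<r∸s 0<r+s (coprime-r+s coprime s≤r 2∣s)
    (≤-trans (*-mono-≤ (+-monoʳ-≤ r (≤-trans s≤r (m≤m+n r 0))) (m∸n≤m r s)) (≤-reflexive 2r*r))

  case₂ : + k / 1 > bound 8 r s 2s<r → Nonnegative (numerator r s k /ₚ (A *ₚ U *ₚ V))
  case₂ bound<k = Numerator.numerator/denominator-nonneg r s k (r ∸ s) (2 * r ∸ s) 1≤s 2s<r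
    (bound⇒8r+4≤k 8 r s k 1≤s 2s<r (*-monoʳ-≤ 8 1≤s) bound<k)
    0<r∸s 0<2r∸s (coprime-2r∸s coprime s≤r)
    (≤-trans (*-mono-≤ (m∸n≤m (2 * r) s) (m∸n≤m r s)) (≤-reflexive 2r*r))

  private
    pochhammers≗ : pochhammer s r 2 *ₚ pochhammer (r ∸ s) r 2 ≗ (A *ₚ S) *ₚ (U *ₚ V)
    pochhammers≗ = *ₚ-cong (two-factors s (+-comm s r)) (two-factors (r ∸ s) (sym (2r∸s≡r∸s+r s≤r)))
      where
      two-factors : ∀ a {b} → a + r ≡ b → pochhammer a r 2 ≗ (1ₚ -ₚ q^ a) *ₚ (1ₚ -ₚ q^ b)
      two-factors a {b} a+r≡b n = trans
        (cong₂ (λ x y → (1ₚ *ₚ (1ₚ -ₚ q^ x) *ₚ (1ₚ -ₚ q^ y)) n)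
          (trans (cong (λ x → a + x) (*-zeroʳ r)) (+-identityʳ a))
          (trans (cong (λ x → a + x) (*-identityʳ r)) a+r≡b))
        (*-congʳ {1ₚ -ₚ q^ b} (*ₚ-identityˡ (1ₚ -ₚ q^ a)) n)

    AU₀≡1 : (A *ₚ U) 0 ≡ 1ℤ
    AU₀≡1 = *ₚ-constant A U (1-q^-constant 1≤s) (1-q^-constant 0<r∸s)

    -- Of the four factors with exponents `s`, `r + s`, `r - s`, `2 r - s`, only `V` is missing from
    -- the denominator of this case.
    fromCase₁ : Nonnegative (numerator r s k /ₚ (A *ₚ U *ₚ S)) →
                Nonnegative (numerator r s k /ₚ (pochhammer s r 2 *ₚ pochhammer (r ∸ s) r 2))
    fromCase₁ 0≤ = Nonnegative-resp
      (/ₚ-congʳ {numerator r s k} (≗-trans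
        (solve 4 (λ a u x v → a :* u :* x :* v := (a :* x) :* (u :* v)) ≗-refl A U S V) (≗-sym pochhammers≗)))
      (/ₚ-factor-nonneg {G = A *ₚ U *ₚ S} (*ₚ-constant (A *ₚ U) S AU₀≡1 (1-q^-constant 0<r+s)) 0<2r∸s 0≤)

    fromCase₂ : Nonnegative (numerator r s k /ₚ (A *ₚ U *ₚ V)) →
                Nonnegative (numerator r s k /ₚ (pochhammer s r 2 *ₚ pochhammer (r ∸ s) r 2))
    fromCase₂ 0≤ = Nonnegative-resp
      (/ₚ-congʳ {numerator r s k} (≗-trans
        (solve 4 (λ a u x v → a :* u :* v :* x := (a :* x) :* (u :* v)) ≗-refl A U S V) (≗-sym pochhammers≗)))
      (/ₚ-factor-nonneg {G = A *ₚ U *ₚ V} (*ₚ-constant (A *ₚ U) V AU₀≡1 (1-q^-constant 0<2r∸s)) 0<r+s 0≤)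

  -- Once the sign is moved into the dividend, `tailSum-numerator` extracts a power of q, and the
  -- numerator quotient remains.
  tail : (2 ∣ s × (+ k / 1 > bound 4 r s 2s<r)) ⊎ (2 ∤ s × (+ k / 1 > bound 8 r s 2s<r)) →
         Nonnegative ((-1ℤ ^ℤ k) · (tailSum r s k /ₚ (⟨q^ s ⨾q^ r ⟩∞ *ₚ ⟨q^ r ∸ s ⨾q^ r ⟩∞)))
  tail cases = Nonnegative-resp (≗-sym (begin
    (-1ℤ ^ℤ k) · (tailSum r s k /ₚ P)
      ≈⟨ ·-/ₚ (-1ℤ ^ℤ k) (tailSum r s k) P P₀≡1 ⟩
    ((-1ℤ ^ℤ k) · tailSum r s k) /ₚ P
      ≈⟨ (λ n → /ₚ-local n {G = P} (λ {i} _ → tailSum-numerator r s k 2s<r i) (λ _ → refl)) ⟩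
    (q^ (exponent r s 0 k) *ₚ numerator r s k) /ₚ P
      ≈⟨ *ₚ-/ₚ (q^ (exponent r s 0 k)) (numerator r s k) P P₀≡1 ⟨
    q^ (exponent r s 0 k) *ₚ (numerator r s k /ₚ P) ∎))
    (*ₚ-nonneg (q^-nonneg (exponent r s 0 k)) (/ₚ-infinite-nonneg {numerator r s k} 1≤s 0<r∸s 0<r (base cases)))
    where
    open ≗-Reasoning
    P : PowerSeries
    P = ⟨q^ s ⨾q^ r ⟩∞ *ₚ ⟨q^ r ∸ s ⨾q^ r ⟩∞
    P₀≡1 : P 0 ≡ 1ℤ
    P₀≡1 = *ₚ-constant ⟨q^ s ⨾q^ r ⟩∞ ⟨q^ r ∸ s ⨾q^ r ⟩∞
      (qPochhammer-constant {s} {r} 1≤s) (qPochhammer-constant {r ∸ s} {r} 0<r∸s)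
    base : (2 ∣ s × (+ k / 1 > bound 4 r s 2s<r)) ⊎ (2 ∤ s × (+ k / 1 > bound 8 r s 2s<r)) →
           Nonnegative (numerator r s k /ₚ (pochhammer s r 2 *ₚ pochhammer (r ∸ s) r 2))
    base (inj₁ (2∣s , bound<k)) = fromCase₁ (case₁ 2∣s bound<k)
    base (inj₂ (_   , bound<k)) = fromCase₂ (case₂ bound<k)

corollary1p9 :
  (r s k : ℕ) → 1 ≤ r → 1 ≤ s → Coprime r s → (2s<r : 2 * s < r) → 1 ≤ k →
  let case₁ = 2 ∣ s × (+ k / 1 > bound 4 r s 2s<r)
      case₂ = 2 ∤ s × (+ k / 1 > bound 8 r s 2s<r)
  in
  (case₁ →
    Nonnegative (numerator r s k /ₚ
      ((1ₚ -ₚ q^ s) *ₚ (1ₚ -ₚ q^ (r ∸ s)) *ₚ (1ₚ -ₚ q^ (r + s)))))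
  × (case₂ →
    Nonnegative (numerator r s k /ₚ
      ((1ₚ -ₚ q^ s) *ₚ (1ₚ -ₚ q^ (r ∸ s)) *ₚ (1ₚ -ₚ q^ (2 * r ∸ s)))))
  × (case₁ ⊎ case₂ →
    Nonnegative ((-1ℤ ^ℤ k) · (tailSum r s k /ₚ
      (⟨q^ s ⨾q^ r ⟩∞ *ₚ ⟨q^ r ∸ s ⨾q^ r ⟩∞))))
corollary1p9 r s k _ 1≤s coprime 2s<r _ =
    (λ (2∣s , bound<k) → case₁ 2∣s bound<k)
  , (λ (_ , bound<k) → case₂ bound<k)
  , tail
  where open Main r s k 1≤s coprime 2s<r
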